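{- Let $F:\mathbb{R}^{n_0}\to\mathbb{R}$ be a ReLU neural network of architecture $(n_0,\dots,n_m;1)$. If $F$ is transversal, then the bent hyperplane arrangement $\mathcal{B}_F$ is the domain (underlying set) of the $(n_0-1)$-skeleton of the canonical polyhedral complex $\mathcal{C}(F)$, and the closures of the activation regions of $F$ are the $n_0$-cells of $\mathcal{C}(F)$.
   Context: **ReLU networks.** $\mathrm{ReLU}(x)=\max\{0,x\}$, and $\sigma:\mathbb{R}^n\to\mathbb{R}^n$ applies ReLU to each coordinate. A ReLU neural network of architecture $(n_0,\dots,n_m;1)$ (positive integers $n_0,\ldots,n_m$, $n_{m+1}=1$) is a sequence of affine maps $A_i:\mathbb{R}^{n_{i-1}}\to\mathbb{R}^{n_i}$, $i=1,\dots,m+1$; its layer maps are $F_i=\sigma\circ A_i$ for $i\le m$ and $G=A_{m+1}$, and the network map is $F=G\circ F_m\circ\cdots\circ F_1$. **Hyperplane arrangement of a layer.** Write $A_i(x)=Wx+b$. The $j$-th row gives the set $S_j=\{x: W_j\cdot x+b_j=0\}$. It is degenerate if $W_j=0$, and otherwise it is an affine hyperplane. The hyperplane arrangement $\mathcal{A}^{(i)}$ in $\mathbb{R}^{n_{i-1}}$ associated to $F_i$ is the finite set of the nondegenerate $S_j$. **Polyhedral complexes.** A polyhedral set is a finite intersection of closed affine half-spaces; its dimension is that of its affine hull. Its faces are $\emptyset$, itself, and its intersections with supporting hyperplanes. A polyhedral complex is a finite set of polyhedral sets (cells) closed under taking faces and such that any two cells intersect in a common face. Its domain is the union of its cells. Its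 $k$-skeleton is the subcomplex of cells of dimension $\le k$. A hyperplane arrangement $\mathcal{A}$ in $\mathbb{R}^n$ induces the polyhedral complex $\mathcal{C}(\mathcal{A})$ with domain $\mathbb{R}^n$ whose $n$-cells are the closures of the connected components of $\mathbb{R}^n\setminus\bigcup_{H\in\mathcal{A}}H$ and whose other cells are the faces of these. **Canonical complex.** Let $R^{(i)}=\mathcal{C}(\mathcal{A}^{(i)})$. Set $\mathcal{C}(F_1):=R^{(1)}$ and, for $i=2,\dots,m$, let $\mathcal{C}(F_i\circ\cdots\circ F_1)$ be the polyhedral complex $\{S\cap (F_{i-1}\circ\cdots\circ F_1)^{ -1}(Y): S\in\mathcal{C}(F_{i-1}\circ\cdots\circ F_1),\ Y\in R^{(i)}\}$. The canonical polyhedral complex of $F$ is $\mathcal{C}(F):=\mathcal{C}(F_m\circ\cdots\circ F_1)$. It has domain $\mathbb{R}^{n_0}$ and $F$ is affine-linear on each of its cells. For a network with no hidden layers (an affine map $\mathbb{R}^{n_0}\to\mathbb{R}$) the canonical complex is the trivial decomposition with single nonempty cell $\mathbb{R}^{n_0}$. **Bent hyperplanes and activation regions.** $\mathcal{B}_F^{(1)}=\bigcup_{H\in\mathcal{A}^{(1)}}H$; for $2\le k\le m$, $\mathcal{B}_F^{(k)}=\bigcup_{H\in\mathcal{A}^{(k)}}(F_{k-1}\circ\cdots\circ F_1)^{ -1}(H)$; and $\mathcal{B}_F=\bigcup_{k=1}^m\mathcal{B}_F^{(k)}$ is the bent hyperplane arrangement. An activation region of $F$ is a connected component of $\mathbb{R}^{n_0}\setminus\mathcal{B}_F$.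 **Transversality.** For a polyhedral complex $M$ in $\mathbb{R}^{n_0}$ and $f:|M|\to\mathbb{R}$ affine-linear on cells, $t\in\mathbb{R}$ is a transversal threshold for $f$ and $M$ if for every cell $C$ of dimension $\ge1$ the restriction of $f$ to the relative interior $\mathrm{int}(C)$ is transverse to $\{t\}$ (its differential is surjective at every point of $\mathrm{int}(C)\cap f^{ -1}(t)$), and $f(v)\neq t$ for every $0$-cell $v$. A threshold is transversal for a network if it is so for the network map and its canonical complex. For $i\in\{1,\dots,m\}$, $j\in\{1,\dots,n_i\}$ the node map is $F_{i,j}=\pi_j\circ A_i\circ F_{i-1}\circ\cdots\circ F_1:\mathbb{R}^{n_0}\to\mathbb{R}$ ($\pi_j$ the $j$-th coordinate projection), which is itself a ReLU network of architecture $(n_0,\dots,n_{i-1};1)$. $F$ is transversal if $t=0$ is a transversal threshold for every node map $F_{i,j}$, $1\le i\le m$, $1\le j\le n_i$. -}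

module Defs where

open import Algebra.Bundles using (CommutativeRing)
open import Algebra.Structures using (IsCommutativeRing)
open import Data.Fin.Base using (Fin; zero)
open import Data.Nat.Base as ℕ using (ℕ; NonZero)
open import Data.Product.Base using (Σ; Σ-syntax; ∃-syntax; _×_; _,_)
open import Data.Sum.Base using (_⊎_)
open import Data.Unit.Polymorphic.Base using (⊤)
open import Data.Vec.Functional using (Vector; foldr; map; zipWith; replicate)
open import Function.Base using (id; _∘_)
open import Level using (0ℓ; Lift) renaming (suc to lsuc)
open import Relation.Binary.Bundles using (TotalOrder)
open import Relation.Binary.Structures using (IsTotalOrder)
open import Relation.Nullary.Negation.Core using (¬_)
open import Relation.Unary
  using (Pred; _∈_; _⊆_; _≐_; _∩_; _∪_; _⊢_; ∁; ∅; U; ⋃; Satisfiable)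

-- The real numbers, characterised up to isomorphism as a Dedekind-complete
-- totally ordered field.
record RealNumbers : Set (lsuc 0ℓ) where
  infix  8 -_
  infixl 7 _*_
  infixl 6 _+_
  infix  4 _≈_ _≤_
  field
    ℝ                 : Set
    _≈_ _≤_           : ℝ → ℝ → Set
    _+_ _*_           : ℝ → ℝ → ℝ
    -_                : ℝ → ℝ
    0# 1#             : ℝ
    isCommutativeRing : IsCommutativeRing _≈_ _+_ _*_ -_ 0# 1#
    isTotalOrder      : IsTotalOrder _≈_ _≤_
    0≉1               : ¬ (0# ≈ 1#)
    inverse           : ∀ x → ¬ (x ≈ 0#) → ∃[ y ] (x * y ≈ 1#)
    +-monoˡ-≤         : ∀ {x y} z → x ≤ y → x + z ≤ y + z
    *-nonNeg          : ∀ {x y} → 0# ≤ x → 0# ≤ y → 0# ≤ x * y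

  UpperBound : Pred ℝ 0ℓ → Pred ℝ 0ℓ
  UpperBound P u = ∀ {x} → x ∈ P → x ≤ u

  field
    supremum : (P : Pred ℝ 0ℓ) → Satisfiable P → Satisfiable (UpperBound P) →
               ∃[ s ] (s ∈ UpperBound P × (∀ {u} → u ∈ UpperBound P → s ≤ u))

  commutativeRing : CommutativeRing 0ℓ 0ℓ
  commutativeRing = record { isCommutativeRing = isCommutativeRing }

  totalOrder : TotalOrder 0ℓ 0ℓ 0ℓ
  totalOrder = record { isTotalOrder = isTotalOrder }

module ReLUNetworks (R : RealNumbers) where

  open RealNumbers R
  open CommutativeRing commutativeRing using (_-_; setoid; semiring)
  open import Algebra.Properties.Semiring.Sum semiring using (sum)
  open import Algebra.Construct.NaturalChoice.Max totalOrder using (_⊔_)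
  open import Data.Vec.Functional.Relation.Binary.Equality.Setoid setoid using (_≋_)
  open import Relation.Binary.Construct.NonStrictToStrict _≈_ _≤_ using (_<_)

  private variable
    k n n₀ : ℕ

  infixl 7 _•_ _·_
  infixl 6 _⊕_ _⊖_

  0ᵛ : Vector ℝ n
  0ᵛ = replicate _ 0#

  _⊕_ _⊖_ : Vector ℝ n → Vector ℝ n → Vector ℝ n
  _⊕_ = zipWith _+_
  _⊖_ = zipWith _-_

  _•_ : ℝ → Vector ℝ n → Vector ℝ n
  c • x = map (c *_) x

  _·_ : Vector ℝ n → Vector ℝ n → ℝ
  w · x = sum (zipWith _*_ w x)

  combination : Vector ℝ k → Vector (Vector ℝ n) k → Vector ℝ n
  combination c v = foldr _⊕_ 0ᵛ (zipWith _•_ c v)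

  ∣_∣ : ℝ → ℝ
  ∣ x ∣ = x ⊔ (- x)

  -- The maximum norm; being equivalent to the Euclidean norm, it gives the
  -- same topology on ℝⁿ and the same differentials.
  ‖_‖ : Vector ℝ n → ℝ
  ‖ x ‖ = foldr _⊔_ 0# (map ∣_∣ x)

  Subset : ℕ → Set₁
  Subset n = Pred (Vector ℝ n) 0ℓ

  Open : Subset n → Set
  Open V = ∀ {x} → x ∈ V → ∃[ ε ] (0# < ε × (∀ y → ‖ y ⊖ x ‖ < ε → y ∈ V))

  closure : Subset n → Subset n
  closure S x = ∀ ε → 0# < ε → ∃[ y ] (y ∈ S × ‖ y ⊖ x ‖ < ε)

  Connected : Subset n → Set₁
  Connected S = ∀ V W → Open V → Open W → S ⊆ V ∪ W →
                Satisfiable (S ∩ V) → Satisfiable (S ∩ W) →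
                Satisfiable (S ∩ (V ∩ W))

  ConnectedComponent : Subset n → Subset n → Set₁
  ConnectedComponent S K =
    Satisfiable K × K ⊆ S × Connected K ×
    (∀ K′ → K′ ⊆ S → Connected K′ → K ⊆ K′ → K′ ⊆ K)

  affineHull : Subset n → Subset n
  affineHull {n} S x =
    ∃[ k ] Σ[ p ∈ Vector (Vector ℝ n) k ] Σ[ c ∈ Vector ℝ k ]
      ((∀ i → p i ∈ S) × sum c ≈ 1# × x ≋ combination c p)

  LinearlyIndependent : Vector (Vector ℝ n) k → Set
  LinearlyIndependent v = ∀ c → combination c v ≋ 0ᵛ → c ≋ 0ᵛ

  affineSpan : Vector ℝ n → Vector (Vector ℝ n) k → Subset n
  affineSpan p v x = ∃[ c ] (x ≋ p ⊕ combination c v)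

  -- The empty set has no dimension in this sense.
  HasDimension : Subset n → ℕ → Set
  HasDimension {n} S d =
    Σ[ p ∈ Vector ℝ n ] Σ[ v ∈ Vector (Vector ℝ n) d ]
      (LinearlyIndependent v × affineHull S ≐ affineSpan p v)

  relInt : Subset n → Subset n
  relInt S x =
    x ∈ S ×
    ∃[ ε ] (0# < ε × (∀ y → y ∈ affineHull S → ‖ y ⊖ x ‖ < ε → y ∈ S))

  -- For x in the affine hull of S this is the direction space of that hull,
  -- i.e. the tangent space at x of the manifold relInt S.
  tangentSpace : Subset n → Vector ℝ n → Subset n
  tangentSpace S x v = x ⊕ v ∈ affineHull S

  -- A polyhedral complex is given by its cells, as a family of sets closed under _≐_.
  Complex : ℕ → Set₂
  Complex n = Pred (Subset n) (lsuc 0ℓ)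

  hyperplane : Vector ℝ n → ℝ → Subset n
  hyperplane w b x = w · x + b ≈ 0#

  Supporting : Subset n → Vector ℝ n → ℝ → Set
  Supporting P w b =
    ¬ (w ≋ 0ᵛ) × (∀ {x} → x ∈ P → w · x + b ≤ 0#) ×
    Satisfiable (P ∩ hyperplane w b)

  IsFace : Subset n → Subset n → Set
  IsFace P C =
    C ≐ ∅ ⊎ C ≐ P ⊎
    ∃[ w ] ∃[ b ] (Supporting P w b × C ≐ P ∩ hyperplane w b)

  -- A hyperplane arrangement is passed as an indexed family of hyperplanes.
  arrangementComplex : {I : Set} → (I → Subset n) → Complex n
  arrangementComplex {I = I} H C =
    ∃[ K ] (ConnectedComponent (∁ (⋃ I H)) K × IsFace (closure K) C)

  domain : Complex n → Pred (Vector ℝ n) (lsuc 0ℓ)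
  domain M x = ∃[ C ] (C ∈ M × x ∈ C)

  skeleton : ℕ → Complex n → Complex n
  skeleton k M C = C ∈ M × (C ≐ ∅ ⊎ ∃[ d ] (d ℕ.≤ k × HasDimension C d))

  record AffineMap (m n : ℕ) : Set where
    constructor affine
    field
      weight : Vector (Vector ℝ m) n
      bias   : Vector ℝ n

    apply : Vector ℝ m → Vector ℝ n
    apply x j = weight j · x + bias j

    rowSet : Fin n → Subset m
    rowSet j = hyperplane (weight j) (bias j)

    Nondegenerate : Fin n → Set
    Nondegenerate j = ¬ (weight j ≋ 0ᵛ)

    arrangement : Σ (Fin n) Nondegenerate → Subset m
    arrangement (j , _) = rowSet j

  open AffineMap public

  row : {m n : ℕ} → AffineMap m n → Fin n → AffineMap m 1
  row A j = affine (λ _ → weight A j) (λ _ → bias A j)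

  relu : ℝ → ℝ
  relu x = 0# ⊔ x

  σ : Vector ℝ n → Vector ℝ n
  σ = map relu

  infixl 5 _▷_

  -- input ▷ n₁ ▷ … ▷ nₘ stands for (n₀, n₁, …, nₘ).
  data Architecture (n₀ : ℕ) : Set where
    input : Architecture n₀
    _▷_   : Architecture n₀ → (n : ℕ) → .{{NonZero n}} → Architecture n₀

  width : Architecture n₀ → ℕ
  width {n₀} input = n₀
  width (a ▷ n)    = n

  -- [] ▷ A₁ ▷ … ▷ Aₘ
  data HiddenLayers {n₀ : ℕ} : Architecture n₀ → Set where
    []  : HiddenLayers input
    _▷_ : ∀ {a n} .{{_ : NonZero n}} →
          HiddenLayers a → AffineMap (width a) n → HiddenLayers (a ▷ n)

  record Network {n₀ : ℕ} (a : Architecture n₀) : Set where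
    constructor network
    field
      hidden : HiddenLayers a
      output : AffineMap (width a) 1

  open Network public

  -- Fₘ ∘ … ∘ F₁
  layerMap : {a : Architecture n₀} →
             HiddenLayers a → Vector ℝ n₀ → Vector ℝ (width a)
  layerMap []      = id
  layerMap (L ▷ A) = σ ∘ apply A ∘ layerMap L

  networkMap : {a : Architecture n₀} → Network a → Vector ℝ n₀ → ℝ
  networkMap F x = apply (output F) (layerMap (hidden F) x) zero

  layerComplex : {a : Architecture n₀} → HiddenLayers a → Complex n₀
  layerComplex []                C = Lift _ (C ≐ ∅ ⊎ C ≐ U)
  layerComplex ([] ▷ A)          C = C ∈ arrangementComplex (arrangement A)
  layerComplex (L@(_ ▷ _) ▷ A)   C =
    ∃[ S ] ∃[ Y ] (S ∈ layerComplex L ×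
                   Y ∈ arrangementComplex (arrangement A) ×
                   C ≐ S ∩ (layerMap L ⊢ Y))

  canonicalComplex : {a : Architecture n₀} → Network a → Complex n₀
  canonicalComplex F = layerComplex (hidden F)

  layersBent : {a : Architecture n₀} → HiddenLayers a → Subset n₀
  layersBent []      = ∅
  layersBent (L ▷ A) = layersBent L ∪ ⋃[ j ∶ _ ] (layerMap L ⊢ arrangement A j)

  bentArrangement : {a : Architecture n₀} → Network a → Subset n₀
  bentArrangement F = layersBent (hidden F)

  ActivationRegion : {a : Architecture n₀} → Network a → Subset n₀ → Set₁
  ActivationRegion F = ConnectedComponent (∁ (bentArrangement F))

  -- v ↦ w · v, restricted to the tangent space of relInt C at x, is the
  -- (Fréchet) differential at x of the restriction of f to relInt C.
  IsDifferential : (Vector ℝ n → ℝ) → Subset n → Vector ℝ n → Vector ℝ n → Set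
  IsDifferential f C x w =
    ∀ ε → 0# < ε → ∃[ δ ] (0# < δ ×
      (∀ y → y ∈ relInt C → ‖ y ⊖ x ‖ < δ →
       ∣ (f y - f x) - w · (y ⊖ x) ∣ ≤ ε * ‖ y ⊖ x ‖))

  SurjectiveDifferential : (Vector ℝ n → ℝ) → Subset n → Vector ℝ n → Set
  SurjectiveDifferential f C x =
    ∃[ w ] (IsDifferential f C x w ×
            (∀ r → ∃[ v ] (v ∈ tangentSpace C x × w · v ≈ r)))

  TransversalThreshold : (Vector ℝ n → ℝ) → Complex n → ℝ → Set₁
  TransversalThreshold f M t =
    (∀ C d → C ∈ M → HasDimension C d → 1 ℕ.≤ d →
       ∀ x → x ∈ relInt C → f x ≈ t → SurjectiveDifferential f C x) ×
    (∀ C → C ∈ M → HasDimension C 0 → ∀ v → v ∈ C → ¬ (f v ≈ t))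

  TransversalNetworkThreshold : {a : Architecture n₀} → Network a → ℝ → Set₁
  TransversalNetworkThreshold F = TransversalThreshold (networkMap F) (canonicalComplex F)

  TransversalLayers : {a : Architecture n₀} → HiddenLayers a → Set₁
  TransversalLayers []      = ⊤
  TransversalLayers (L ▷ A) =
    TransversalLayers L ×
    (∀ j → TransversalNetworkThreshold (network L (row A j)) 0#)

  Transversal : {a : Architecture n₀} → Network a → Set₁
  Transversal F = TransversalLayers (hidden F)

-- Where no node of the network vanishes at x, the points having weakly the same
-- node signs as x form a cell: on a cell every node is an affine function of
-- constant sign, so the points with strictly the same signs are a convex, hence
-- connected, component of the complement of the bent arrangement, and this cell
-- is its closure. Conversely a cell containing such an x is the cell of x, a
-- neighbourhood of x. Transversality enters through one fact: a cell whose affine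
-- hull is the whole space contains a point where no node vanishes. Otherwise some
-- node, with all nodes of earlier layers nonzero at a point x of the cell, would
-- vanish on the cell, hence (being affine on the larger cell of x) near x.
module Submission where

open import Defs
open import Axiom.ExcludedMiddle using (ExcludedMiddle)
open import Algebra.Bundles using (CommutativeRing)
open import Algebra.Solver.Ring.AlmostCommutativeRing using (fromCommutativeRing; _-Raw-AlmostCommutative⟶_)
open import Data.Empty using (⊥; ⊥-elim)
open import Data.Fin.Base using (Fin; zero; suc; punchIn; punchOut)
import Data.Fin.Properties as Fin
open import Data.Integer.Base as ℤ using (ℤ; +_; -[1+_])
import Data.Integer.Properties as ℤ
open import Data.Maybe.Base using (just; nothing)
open import Data.Nat.Base as ℕ using (ℕ; zero; suc; s≤s; NonZero; _∸_)
import Data.Nat.Properties as ℕ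
open import Data.Product.Base using (Σ; ∃-syntax; _×_; _,_; proj₁; proj₂)
import Data.Sign.Base as Sign
open import Data.Sum.Base using (_⊎_; inj₁; inj₂; [_,_]′)
open import Data.Unit.Base using (tt)
open import Data.Vec.Functional using (Vector; head; tail; _∷_) renaming ([] to ε)
open import Function.Bundles using (_⇔_; mk⇔)
open import Level using (lift)
open import Relation.Binary.Definitions using (WeaklyDecidable)
open import Relation.Binary.PropositionalEquality.Core as ≡ using (_≡_)
open import Relation.Nullary using (¬_; Dec; yes; no)
open import Relation.Unary using (_∈_; _⊆_; _≐_; _∩_; _⊢_; ∁; ∅; U; ⋃; Satisfiable)

-- That every single node is nonzero somewhere on a full-dimensional cell does not yet give one
-- point where all of them are. Constant signs close this gap: on a convex set where an affine
-- function keeps one sign, a point strictly between two points is a zero only if both are, so the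
-- witnesses for finitely many nodes merge by passing to points between them.
--
-- The induction over the layers keeps the full-dimensional cell fixed and lets the cells of the
-- earlier layers around it grow. A node vanishing on the fixed cell vanishes on the whole earlier
-- cell, because it is affine there and the fixed cell has full affine hull. That earlier cell is a
-- neighbourhood of one of its points, where the differential of the node is therefore zero, against
-- transversality.
--
-- Cells are handled through sign conditions. Of the lower-dimensional ones the proof needs only
-- convexity, constant node signs, and the existence, through each zero of a node, of a cell on
-- which that node vanishes.

module OrderedField (em : ∀ {ℓ} → ExcludedMiddle ℓ) (R : RealNumbers) where

  open RealNumbers R public
  open CommutativeRing commutativeRing public
    using ( _-_; setoid; refl; sym; trans; reflexive; +-cong; +-congˡ; +-congʳ; *-cong; *-congˡ; *-congʳ; -‿cong
          ; +-identityˡ; +-identityʳ; *-identityˡ; *-identityʳ; zeroˡ; zeroʳ; *-comm; +-comm; -‿inverseʳ; semiring; +-monoid )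
  open import Relation.Binary.Structures using (IsTotalOrder)
  open IsTotalOrder isTotalOrder public
    using (antisym; total) renaming (refl to ≤-refl; trans to ≤-trans; reflexive to ≤-reflexive)
  open import Relation.Binary.Construct.NonStrictToStrict _≈_ _≤_ public using (_<_)

  -- Integer coefficients let the ring solver cancel terms without comparing reals.
  module IntegerCoefficients where
    open import Algebra.Properties.Semiring.Mult.TCOptimised semiring
      using (×1-homo-*) renaming (_×_ to _×′_)
    open import Algebra.Properties.Monoid.Mult.TCOptimised +-monoid using (1+×; ×-homo-+)
    open import Algebra.Properties.Ring (CommutativeRing.ring commutativeRing)
      using (-‿distribˡ-*; -‿distribʳ-*; -0#≈0#; -‿involutive)
    open import Algebra.Properties.AbelianGroup (CommutativeRing.+-abelianGroup commutativeRing)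
      using () renaming (⁻¹-∙-comm to -‿+-comm)
    open import Relation.Binary.Reasoning.Setoid setoid

    ⟦_⟧ : ℤ → ℝ
    ⟦ + n ⟧      = n ×′ 1#
    ⟦ -[1+ n ] ⟧ = - (suc n ×′ 1#)

    ⟦⟧-neg : ∀ i → ⟦ ℤ.- i ⟧ ≈ - ⟦ i ⟧
    ⟦⟧-neg (+ zero)   = sym -0#≈0#
    ⟦⟧-neg (+ suc n)  = refl
    ⟦⟧-neg -[1+ n ]   = sym (-‿involutive _)

    ⟦⟧-⊖ : ∀ m n → ⟦ m ℤ.⊖ n ⟧ ≈ m ×′ 1# - n ×′ 1#
    ⟦⟧-⊖ m zero          = sym (trans (+-congˡ -0#≈0#) (+-identityʳ _))
    ⟦⟧-⊖ zero (suc n)    = sym (+-identityˡ _)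
    ⟦⟧-⊖ (suc m) (suc n) = begin
      ⟦ suc m ℤ.⊖ suc n ⟧         ≡⟨ ≡.cong ⟦_⟧ (ℤ.[1+m]⊖[1+n]≡m⊖n m n) ⟩
      ⟦ m ℤ.⊖ n ⟧                 ≈⟨ ⟦⟧-⊖ m n ⟩
      M - N                       ≈⟨ +-congʳ (+-identityˡ M) ⟨
      0# + M - N                  ≈⟨ +-congʳ (+-congʳ (-‿inverseʳ 1#)) ⟨
      1# - 1# + M - N             ≈⟨ +-congʳ (CommutativeRing.+-assoc commutativeRing _ _ _) ⟩
      1# + (- 1# + M) - N         ≈⟨ +-congʳ (+-congˡ (+-comm _ _)) ⟩
      1# + (M - 1#) - N           ≈⟨ +-congʳ (CommutativeRing.+-assoc commutativeRing _ _ _) ⟨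
      1# + M - 1# - N             ≈⟨ CommutativeRing.+-assoc commutativeRing _ _ _ ⟩
      1# + M + (- 1# - N)         ≈⟨ +-congˡ (-‿+-comm 1# N) ⟩
      1# + M - (1# + N)           ≈⟨ +-cong (1+× m 1#) (-‿cong (1+× n 1#)) ⟨
      suc m ×′ 1# - suc n ×′ 1#   ∎
      where M = m ×′ 1# ; N = n ×′ 1#

    ⟦⟧-+ : ∀ i j → ⟦ i ℤ.+ j ⟧ ≈ ⟦ i ⟧ + ⟦ j ⟧
    ⟦⟧-+ (+ m)    (+ n)    = ×-homo-+ 1# m n
    ⟦⟧-+ (+ m)    -[1+ n ] = ⟦⟧-⊖ m (suc n)
    ⟦⟧-+ -[1+ m ] (+ n)    = trans (⟦⟧-⊖ n (suc m)) (+-comm _ _)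
    ⟦⟧-+ -[1+ m ] -[1+ n ] = trans
      (-‿cong (trans (reflexive (≡.cong (λ k → suc k ×′ 1#) (≡.sym (ℕ.+-suc m n)))) (×-homo-+ 1# (suc m) (suc n))))
      (sym (-‿+-comm _ _))

    ⟦⟧-◃ : ∀ n → ⟦ Sign.- ℤ.◃ n ⟧ ≈ - (n ×′ 1#)
    ⟦⟧-◃ zero    = sym -0#≈0#
    ⟦⟧-◃ (suc n) = refl

    ⟦⟧-+◃ : ∀ n → ⟦ Sign.+ ℤ.◃ n ⟧ ≈ n ×′ 1#
    ⟦⟧-+◃ n = reflexive (≡.cong ⟦_⟧ (ℤ.+◃n≡+n n))

    ⟦⟧-* : ∀ i j → ⟦ i ℤ.* j ⟧ ≈ ⟦ i ⟧ * ⟦ j ⟧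
    ⟦⟧-* (+ m)    (+ n)    = trans (⟦⟧-+◃ (m ℕ.* n)) (×1-homo-* m n)
    ⟦⟧-* (+ m)    -[1+ n ] = trans (⟦⟧-◃ (m ℕ.* suc n)) (trans (-‿cong (×1-homo-* m (suc n))) (-‿distribʳ-* _ _))
    ⟦⟧-* -[1+ m ] (+ n)    = trans (⟦⟧-◃ (suc m ℕ.* n)) (trans (-‿cong (×1-homo-* (suc m) n)) (-‿distribˡ-* _ _))
    ⟦⟧-* -[1+ m ] -[1+ n ] = begin
      (suc m ℕ.* suc n) ×′ 1#        ≈⟨ ×1-homo-* (suc m) (suc n) ⟩
      M * N                          ≈⟨ -‿involutive _ ⟨
      - - (M * N)                    ≈⟨ -‿cong (-‿distribʳ-* M N) ⟩
      - (M * - N)                    ≈⟨ -‿distribˡ-* M (- N) ⟩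
      - M * - N                      ∎
      where M = suc m ×′ 1# ; N = suc n ×′ 1#

    morphism : ℤ.+-*-rawRing -Raw-AlmostCommutative⟶ fromCommutativeRing commutativeRing
    morphism = record
      { ⟦_⟧ = ⟦_⟧ ; +-homo = ⟦⟧-+ ; *-homo = ⟦⟧-* ; -‿homo = ⟦⟧-neg ; 0-homo = refl ; 1-homo = refl }

    _coeff≟_ : WeaklyDecidable (λ i j → ⟦ i ⟧ ≈ ⟦ j ⟧)
    i coeff≟ j with i ℤ.≟ j
    ... | yes ≡.refl = just refl
    ... | no _       = nothing

  open import Algebra.Solver.Ring ℤ.+-*-rawRing (fromCommutativeRing commutativeRing)
    IntegerCoefficients.morphism IntegerCoefficients._coeff≟_ public
    using (solve; con; _:=_; _:+_; _:*_; _:-_; :-_)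

  -- Inequalities in a classically decidable ordered field.

  opaque

    ≈? : ∀ x y → Dec (x ≈ y)
    ≈? x y = em

    -0≈0 : - 0# ≈ 0#
    -0≈0 = solve 0 (:- con (+ 0) := con (+ 0)) refl

    ≤-resp : ∀ {x x′ y y′} → x ≈ x′ → y ≈ y′ → x ≤ y → x′ ≤ y′
    ≤-resp p q r = ≤-trans (≤-reflexive (sym p)) (≤-trans r (≤-reflexive q))

    <-resp : ∀ {x x′ y y′} → x ≈ x′ → y ≈ y′ → x < y → x′ < y′
    <-resp p q (r , s) = ≤-resp p q r , λ e → s (trans p (trans e (sym q)))

    ≤⇒≯ : ∀ {x y} → x ≤ y → ¬ (y < x)
    ≤⇒≯ p (q , r) = r (antisym q p)

    <-irrefl : ∀ {x y} → x ≈ y → ¬ (x < y)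
    <-irrefl p (_ , q) = q p

    ≰⇒> : ∀ {x y} → ¬ (x ≤ y) → y < x
    ≰⇒> {x} {y} p with total x y
    ... | inj₁ q = ⊥-elim (p q)
    ... | inj₂ q = q , λ e → p (≤-reflexive (sym e))

    ≮⇒≥ : ∀ {x y} → ¬ (x < y) → y ≤ x
    ≮⇒≥ {x} {y} p with total x y
    ... | inj₂ q = q
    ... | inj₁ q with ≈? x y
    ...   | yes e = ≤-reflexive (sym e)
    ...   | no e  = ⊥-elim (p (q , e))

    <-≤-trans : ∀ {x y z} → x < y → y ≤ z → x < z
    <-≤-trans (p , q) r = ≤-trans p r , λ e → q (antisym p (≤-trans r (≤-reflexive (sym e))))

    ≤-<-trans : ∀ {x y z} → x ≤ y → y < z → x < z
    ≤-<-trans p (q , r) = ≤-trans p q , λ e → r (antisym q (≤-trans (≤-reflexive (sym e)) p))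

    compare : ∀ x y → x < y ⊎ x ≈ y ⊎ y < x
    compare x y with ≈? x y | total x y
    ... | yes e | _      = inj₂ (inj₁ e)
    ... | no e  | inj₁ p = inj₁ (p , e)
    ... | no e  | inj₂ p = inj₂ (inj₂ (p , λ q → e (sym q)))

    ≤⇒0≤- : ∀ {x y} → x ≤ y → 0# ≤ y - x
    ≤⇒0≤- {x} p = ≤-resp (-‿inverseʳ x) refl (+-monoˡ-≤ (- x) p)

    0≤-⇒≤ : ∀ {x y} → 0# ≤ y - x → x ≤ y
    0≤-⇒≤ {x} {y} p = ≤-resp (+-identityˡ x) (solve 2 (λ x y → y :- x :+ x := y) refl x y) (+-monoˡ-≤ x p)

    -≈0⇒≈ : ∀ {x y} → y - x ≈ 0# → x ≈ y
    -≈0⇒≈ {x} {y} e = trans (sym (+-identityˡ x)) (trans (+-congʳ (sym e)) (solve 2 (λ x y → y :- x :+ x := y) refl x y))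

    <⇒0<- : ∀ {x y} → x < y → 0# < y - x
    <⇒0<- (p , q) = ≤⇒0≤- p , λ e → q (-≈0⇒≈ (sym e))

    -- Reduces an inequality to a sign fact about some `t` and a ring identity, which the solver can
    -- check.
    by-≤ : ∀ {x y t} → 0# ≤ t → t ≈ y - x → x ≤ y
    by-≤ p e = 0≤-⇒≤ (≤-resp refl e p)

    by-< : ∀ {x y t} → 0# < t → t ≈ y - x → x < y
    by-< {x} {y} (p , q) e = by-≤ p e , λ x≈y → q (sym (trans e (trans (+-congˡ (-‿cong x≈y)) (-‿inverseʳ y))))

    +-nonNeg : ∀ {x y} → 0# ≤ x → 0# ≤ y → 0# ≤ x + y
    +-nonNeg {x} {y} p q = ≤-trans q (by-≤ p (solve 2 (λ x y → x := x :+ y :- y) refl x y))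

    +-pos-nonNeg : ∀ {x y} → 0# < x → 0# ≤ y → 0# < x + y
    +-pos-nonNeg {x} {y} p q = ≤-<-trans q (by-< p (solve 2 (λ x y → x := x :+ y :- y) refl x y))

    *-pos : ∀ {x y} → 0# < x → 0# < y → 0# < x * y
    *-pos {x} {y} (p , p′) (q , q′) = *-nonNeg p q , λ e →
      let x⁻¹ , i = inverse x (λ x≈0 → p′ (sym x≈0)) in
      q′ (sym (trans (sym (*-identityˡ y)) (trans (*-congʳ (sym i))
        (trans (solve 3 (λ x y z → x :* z :* y := x :* y :* z) refl x y x⁻¹) (trans (*-congʳ (sym e)) (zeroˡ _))))))

    neg-nonNeg : ∀ {x} → x ≤ 0# → 0# ≤ - x
    neg-nonNeg {x} p = ≤-resp refl (+-identityˡ _) (≤⇒0≤- p)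

    neg-pos : ∀ {x} → x < 0# → 0# < - x
    neg-pos {x} p = <-resp refl (+-identityˡ _) (<⇒0<- p)

    neg-nonPos : ∀ {x} → 0# ≤ x → - x ≤ 0#
    neg-nonPos {x} p = by-≤ p (solve 1 (λ x → x := con (+ 0) :- (:- x)) refl x)

    0≤x² : ∀ x → 0# ≤ x * x
    0≤x² x with total 0# x
    ... | inj₁ p = *-nonNeg p p
    ... | inj₂ p = ≤-resp refl (solve 1 (λ x → :- x :* :- x := x :* x) refl x) (*-nonNeg (neg-nonNeg p) (neg-nonNeg p))

    0<x² : ∀ {x} → ¬ (x ≈ 0#) → 0# < x * x
    0<x² {x} x≉0 with compare 0# x
    ... | inj₁ p        = *-pos p p
    ... | inj₂ (inj₁ e) = ⊥-elim (x≉0 (sym e))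
    ... | inj₂ (inj₂ p) = <-resp refl (solve 1 (λ x → :- x :* :- x := x :* x) refl x) (*-pos (neg-pos p) (neg-pos p))

    0<1 : 0# < 1#
    0<1 = ≤-resp refl (*-identityˡ 1#) (0≤x² 1#) , 0≉1

  opaque

    inverse-pos : ∀ {x} → 0# < x → ∃[ y ] (0# < y × x * y ≈ 1#)
    inverse-pos {x} p with inverse x (λ e → proj₂ p (sym e))
    ... | y , i = y , ≰⇒> (λ y≤0 → <-irrefl refl (<-≤-trans 0<1 (≤-resp i refl (x*y≤0 y≤0)))) , i
      where
      x*y≤0 : y ≤ 0# → x * y ≤ 0#
      x*y≤0 q = by-≤ (*-nonNeg (proj₁ p) (neg-nonNeg q)) (solve 2 (λ x y → x :* :- y := con (+ 0) :- x :* y) refl x y)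

  opaque

    *-monoʳ-≤ : ∀ {x y z} → 0# ≤ x → y ≤ z → x * y ≤ x * z
    *-monoʳ-≤ {x} {y} {z} p q = by-≤ (*-nonNeg p (≤⇒0≤- q)) (solve 3 (λ x y z → x :* (z :- y) := x :* z :- x :* y) refl x y z)

    *-monoʳ-< : ∀ {x y z} → 0# < x → y < z → x * y < x * z
    *-monoʳ-< {x} {y} {z} p q = by-< (*-pos p (<⇒0<- q)) (solve 3 (λ x y z → x :* (z :- y) := x :* z :- x :* y) refl x y z)

    +-mono-≤ : ∀ {x y z w} → x ≤ y → z ≤ w → x + z ≤ y + w
    +-mono-≤ {x} {y} {z} {w} p q = by-≤ (+-nonNeg (≤⇒0≤- p) (≤⇒0≤- q))
      (solve 4 (λ x y z w → (y :- x) :+ (w :- z) := (y :+ w) :- (x :+ z)) refl x y z w)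

  opaque

    -- The witness is the inverse of 1 + 1, but only its position strictly between 0 and 1 is
    -- exported; that is all later uses rely on, `midpoint` included.
    0<half : ∃[ h ] (0# < h × h < 1#)
    0<half with inverse-pos (+-pos-nonNeg 0<1 (proj₁ 0<1))
    ... | h , 0<h , 2h≈1 = h , 0<h , by-< 0<h (trans (solve 1 (λ h → h := h :+ h :- h) refl h) (+-congʳ h+h≈1))
      where
      h+h≈1 : h + h ≈ 1#
      h+h≈1 = trans (solve 1 (λ h → h :+ h := (con (+ 1) :+ con (+ 1)) :* h) refl h) 2h≈1

  opaque

    minimum : ∀ {x y} → 0# < x → 0# < y → ∃[ z ] (0# < z × z ≤ x × z ≤ y)
    minimum {x} {y} p q with total x y
    ... | inj₁ x≤y = x , p , ≤-refl , x≤y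
    ... | inj₂ y≤x = y , q , y≤x , ≤-refl

-- Vectors, neighbourhoods in the maximum norm, and continuity of the layer maps.

module Topology (em : ∀ {ℓ} → ExcludedMiddle ℓ) (R : RealNumbers) where
  open OrderedField em R public
  open ReLUNetworks R public
  open import Algebra.Properties.Semiring.Sum semiring public
    using (sum; sum-cong-≋; ∑-distrib-+; *-distribˡ-sum; *-distribʳ-sum)
  open import Algebra.Construct.NaturalChoice.Max totalOrder public using (_⊔_; maxOperator)
  open import Algebra.Construct.NaturalChoice.MaxOp maxOperator public using (x≤x⊔y; x≤y⊔x; ⊔-lub)
  open import Data.Vec.Functional.Relation.Binary.Equality.Setoid setoid public using (_≋_)

  private variable
    m n k : ℕ

  opaque

    ≋-sym : {x y : Vector ℝ n} → x ≋ y → y ≋ x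
    ≋-sym e i = sym (e i)

    ≋-trans : {x y z : Vector ℝ n} → x ≋ y → y ≋ z → x ≋ z
    ≋-trans e f i = trans (e i) (f i)

    ·-cong : {w w′ x x′ : Vector ℝ n} → w ≋ w′ → x ≋ x′ → w · x ≈ w′ · x′
    ·-cong e f = sum-cong-≋ (λ i → *-cong (e i) (f i))

    ·-congʳ : (w : Vector ℝ n) {x x′ : Vector ℝ n} → x ≋ x′ → w · x ≈ w · x′
    ·-congʳ w f = ·-cong {w = w} (λ _ → refl) f

    ·-comm : (w x : Vector ℝ n) → w · x ≈ x · w
    ·-comm w x = sum-cong-≋ (λ i → *-comm (w i) (x i))

    ·-distribˡ-⊕ : (w x y : Vector ℝ n) → w · (x ⊕ y) ≈ w · x + w · y
    ·-distribˡ-⊕ w x y = trans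
      (sum-cong-≋ (λ i → solve 3 (λ a b c → a :* (b :+ c) := a :* b :+ a :* c) refl (w i) (x i) (y i)))
      (∑-distrib-+ (λ i → w i * x i) (λ i → w i * y i))

    ·-• : (w : Vector ℝ n) (c : ℝ) (x : Vector ℝ n) → w · (c • x) ≈ c * (w · x)
    ·-• w c x = trans
      (sum-cong-≋ (λ i → solve 3 (λ a b c → a :* (b :* c) := b :* (a :* c)) refl (w i) c (x i)))
      (sym (*-distribˡ-sum c (λ i → w i * x i)))

    ·-distribʳ-⊕ : (w w′ x : Vector ℝ n) → (w ⊕ w′) · x ≈ w · x + w′ · x
    ·-distribʳ-⊕ w w′ x = trans (·-comm (w ⊕ w′) x) (trans (·-distribˡ-⊕ x w w′) (+-cong (·-comm x w) (·-comm x w′)))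

    •-· : (c : ℝ) (w x : Vector ℝ n) → (c • w) · x ≈ c * (w · x)
    •-· c w x = trans (·-comm (c • w) x) (trans (·-• x c w) (*-congˡ (·-comm x w)))

    sum-zero : {x : Vector ℝ n} → (∀ i → x i ≈ 0#) → sum x ≈ 0#
    sum-zero {zero}  e = refl
    sum-zero {suc n} e = trans (+-cong (e zero) (sum-zero (λ i → e (suc i)))) (+-identityˡ 0#)

    ·-zeroˡ : {w : Vector ℝ n} (x : Vector ℝ n) → w ≋ 0ᵛ → w · x ≈ 0#
    ·-zeroˡ x e = sum-zero (λ i → trans (*-congʳ (e i)) (zeroˡ _))

    ·-zeroʳ : (w : Vector ℝ n) {x : Vector ℝ n} → x ≋ 0ᵛ → w · x ≈ 0#
    ·-zeroʳ w e = sum-zero (λ i → trans (*-congˡ (e i)) (zeroʳ _))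

    ·-⊖ : (w x y : Vector ℝ n) → w · (x ⊖ y) ≈ w · x - w · y
    ·-⊖ w x y = trans
      (·-congʳ w (λ i → solve 2 (λ a b → a :- b := a :+ :- con (+ 1) :* b) refl (x i) (y i)))
      (trans (·-distribˡ-⊕ w x (- 1# • y))
      (trans (+-congˡ (·-• w (- 1#) y)) (solve 2 (λ a b → a :+ :- con (+ 1) :* b := a :- b) refl (w · x) (w · y))))

    ·-combination : (w : Vector ℝ n) (c : Vector ℝ k) (p : Vector (Vector ℝ n) k) →
                    w · combination c p ≈ sum (λ i → c i * (w · p i))
    ·-combination {k = zero}  w c p = ·-zeroʳ w (λ _ → refl)
    ·-combination {k = suc k} w c p = trans (·-distribˡ-⊕ w (c zero • p zero) _)
      (+-cong (·-• w (c zero) (p zero)) (·-combination w (tail c) (tail p)))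

    -- The first nonzero coordinate contributes a positive square. Its use is geometric: a step
    -- along the normal `w` strictly increases every affine function with weight `w`.
    0<w·w : {w : Vector ℝ n} → ¬ (w ≋ 0ᵛ) → 0# < w · w
    0<w·w {zero}  w≉0 = ⊥-elim (w≉0 (λ ()))
    0<w·w {suc n} {w} w≉0 with ≈? (w zero) 0#
    ... | no p  = +-pos-nonNeg (0<x² p) (0≤w·w (tail w))
      where
      0≤w·w : (w : Vector ℝ m) → 0# ≤ w · w
      0≤w·w {zero}  w = ≤-refl
      0≤w·w {suc m} w = +-nonNeg (0≤x² _) (0≤w·w (tail w))
    ... | yes e = <-resp refl (trans (sym (+-identityˡ _)) (+-congʳ (sym (trans (*-congʳ e) (zeroˡ _)))))
                    (0<w·w {w = tail w} (λ z → w≉0 (λ { zero → e ; (suc i) → z i })))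

    0≤‖_‖ : (v : Vector ℝ n) → 0# ≤ ‖ v ‖
    0≤‖_‖ {zero}  v = ≤-refl
    0≤‖_‖ {suc n} v = ≤-trans 0≤‖ tail v ‖ (x≤y⊔x ∣ head v ∣ ‖ tail v ‖)

    ∣x∣≤‖x‖ : (v : Vector ℝ n) → ∀ i → ∣ v i ∣ ≤ ‖ v ‖
    ∣x∣≤‖x‖ v zero    = x≤x⊔y ∣ head v ∣ ‖ tail v ‖
    ∣x∣≤‖x‖ v (suc i) = ≤-trans (∣x∣≤‖x‖ (tail v) i) (x≤y⊔x ∣ head v ∣ ‖ tail v ‖)

  opaque

    x≤‖x‖ : (v : Vector ℝ n) → ∀ i → v i ≤ ‖ v ‖
    x≤‖x‖ v i = ≤-trans (x≤x⊔y (v i) (- v i)) (∣x∣≤‖x‖ v i)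

    -x≤‖x‖ : (v : Vector ℝ n) → ∀ i → - v i ≤ ‖ v ‖
    -x≤‖x‖ v i = ≤-trans (x≤y⊔x (v i) (- v i)) (∣x∣≤‖x‖ v i)

    ‖‖-lub : {v : Vector ℝ n} {r : ℝ} → 0# ≤ r → (∀ i → v i ≤ r × - v i ≤ r) → ‖ v ‖ ≤ r
    ‖‖-lub {zero}  p q = p
    ‖‖-lub {suc n} p q = ⊔-lub (⊔-lub (proj₁ (q zero)) (proj₂ (q zero))) (‖‖-lub p (λ i → q (suc i)))

    ⊔-lub-< : ∀ {x y z} → x < z → y < z → x ⊔ y < z
    ⊔-lub-< {x} {y} p q with total x y
    ... | inj₁ x≤y = ≤-<-trans (⊔-lub x≤y ≤-refl) q
    ... | inj₂ y≤x = ≤-<-trans (⊔-lub ≤-refl y≤x) p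

    ‖‖-lub-< : {v : Vector ℝ n} {r : ℝ} → 0# < r → (∀ i → v i < r × - v i < r) → ‖ v ‖ < r
    ‖‖-lub-< {zero}  p q = p
    ‖‖-lub-< {suc n} p q = ⊔-lub-< (⊔-lub-< (proj₁ (q zero)) (proj₂ (q zero))) (‖‖-lub-< p (λ i → q (suc i)))

  opaque

    -- The constant is the sum of the absolute values of the entries of `w`. A free bound `r`
    -- replaces the norm of `v` so that the tail can be estimated by the norm of the whole vector.
    ·-bound : (w : Vector ℝ n) →
              ∃[ c ] (0# ≤ c × (∀ v {r} → ‖ v ‖ ≤ r → w · v ≤ c * r × - (w · v) ≤ c * r))
    ·-bound {zero}  w = 0# , ≤-refl , λ v _ →
      ≤-reflexive (sym (zeroˡ _)) , ≤-reflexive (solve 1 (λ r → :- con (+ 0) := con (+ 0) :* r) refl _)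
    ·-bound {suc n} w with ·-bound (tail w)
    ... | c , 0≤c , bound = a + c , +-nonNeg 0≤a 0≤c , λ v {r} ‖v‖≤r →
      let tail≤ = bound (tail v) (≤-trans (x≤y⊔x ∣ head v ∣ ‖ tail v ‖) ‖v‖≤r)
          head≤ = a-bound (≤-trans (x≤‖x‖ v zero) ‖v‖≤r) (≤-trans (-x≤‖x‖ v zero) ‖v‖≤r)
      in ≤-resp refl (distrib a c r) (+-mono-≤ (proj₁ head≤) (proj₁ tail≤)) ,
         ≤-resp (solve 2 (λ x y → :- x :+ :- y := :- (x :+ y)) refl (w zero * v zero) (tail w · tail v))
           (distrib a c r) (+-mono-≤ (proj₂ head≤) (proj₂ tail≤))
      where
      distrib : ∀ a c r → a * r + c * r ≈ (a + c) * r
      distrib = solve 3 (λ a c r → a :* r :+ c :* r := (a :+ c) :* r) refl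
      abs-bound : ∀ u → ∃[ a ] (0# ≤ a × (∀ {x r} → x ≤ r → - x ≤ r → u * x ≤ a * r × - (u * x) ≤ a * r))
      abs-bound u with total 0# u
      ... | inj₁ p = u , p , λ q q′ → *-monoʳ-≤ p q ,
        ≤-resp (solve 2 (λ u x → u :* :- x := :- (u :* x)) refl u _) refl (*-monoʳ-≤ p q′)
      ... | inj₂ p = - u , neg-nonNeg p , λ q q′ →
        ≤-resp (solve 2 (λ u x → :- u :* :- x := u :* x) refl u _) refl (*-monoʳ-≤ (neg-nonNeg p) q′) ,
        ≤-resp (solve 2 (λ u x → :- u :* x := :- (u :* x)) refl u _) refl (*-monoʳ-≤ (neg-nonNeg p) q)
      a   : ℝ
      a   = proj₁ (abs-bound (w zero))
      0≤a : 0# ≤ a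
      0≤a = proj₁ (proj₂ (abs-bound (w zero)))
      a-bound : ∀ {x r} → x ≤ r → - x ≤ r → w zero * x ≤ a * r × - (w zero * x) ≤ a * r
      a-bound = proj₂ (proj₂ (abs-bound (w zero)))

  -- The neighbourhoods of `x`. `Open V` unfolds to `Near x V` for all `x` in `V`, so proofs of
  -- openness are used directly as proofs of `Near`.
  Near : Vector ℝ n → Subset n → Set
  Near x P = ∃[ ε ] (0# < ε × (∀ y → ‖ y ⊖ x ‖ < ε → y ∈ P))

  module _ {x : Vector ℝ n} where

    opaque

      near-mono : {P Q : Subset n} → P ⊆ Q → Near x P → Near x Q
      near-mono f (ε , 0<ε , p) = ε , 0<ε , λ y q → f (p y q)

      near-∩ : {P Q : Subset n} → Near x P → Near x Q → Near x (P ∩ Q)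
      near-∩ (ε , 0<ε , p) (ε′ , 0<ε′ , p′) with minimum 0<ε 0<ε′
      ... | δ , 0<δ , δ≤ε , δ≤ε′ = δ , 0<δ , λ y q → p y (<-≤-trans q δ≤ε) , p′ y (<-≤-trans q δ≤ε′)

      near-U : {P : Subset n} → (∀ y → y ∈ P) → Near x P
      near-U p = 1# , 0<1 , λ y _ → p y

    opaque

      near-∀ : {P : Fin k → Subset n} → (∀ j → Near x (P j)) → Near x (λ y → ∀ j → y ∈ P j)
      near-∀ {zero}  p = near-U (λ y ())
      near-∀ {suc k} p = near-mono (λ { (q , r) zero → q ; (q , r) (suc j) → r j })
                           (near-∩ (p zero) (near-∀ (λ j → p (suc j))))

      -- A subset need not respect `≋`. A neighbourhood of `x` does so at `x`, since a vector equal
      -- to `x` is at distance 0 from it.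
      near-resp : {P : Subset n} {y : Vector ℝ n} → y ≋ x → Near x P → y ∈ P
      near-resp {y = y} e (ε , 0<ε , p) = p y (‖‖-lub-< 0<ε (λ i →
        <-resp (sym (y-x≈0 i)) refl 0<ε , <-resp (sym (trans (-‿cong (y-x≈0 i)) -0≈0)) refl 0<ε))
        where
        y-x≈0 : ∀ i → y i - x i ≈ 0#
        y-x≈0 i = trans (+-congʳ (e i)) (-‿inverseʳ (x i))

      near-self : {P : Subset n} → Near x P → x ∈ P
      near-self {P} = near-resp {P} {x} (λ _ → refl)

    opaque

      -- The bound on `t` is `ε` divided by `‖ v ‖ + 1#`; adding 1 keeps the denominator positive
      -- when `v` vanishes.
      near-line : {P : Subset n} → Near x P → ∀ v →
                  ∃[ t₀ ] (0# < t₀ × (∀ {t y} → 0# ≤ t → t < t₀ → y ≋ x ⊕ t • v → y ∈ P))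
      near-line (ε , 0<ε , p) v with inverse-pos (<-resp refl (+-comm 1# ‖ v ‖) (+-pos-nonNeg 0<1 0≤‖ v ‖))
      ... | δ , 0<δ , N*δ≈1 = ε * δ , *-pos 0<ε 0<δ , λ {t} {y} 0≤t t<t₀ e → p y (‖‖-lub-< 0<ε (λ i →
          <-resp (sym (y-x e i)) refl (≤-<-trans (*-monoʳ-≤ 0≤t (x≤‖x‖ v i)) (small 0≤t t<t₀)) ,
          <-resp (sym (trans (-‿cong (y-x e i)) (solve 2 (λ t v → :- (t :* v) := t :* :- v) refl t (v i)))) refl
            (≤-<-trans (*-monoʳ-≤ 0≤t (-x≤‖x‖ v i)) (small 0≤t t<t₀))))
        where
        y-x : ∀ {t y} → y ≋ x ⊕ t • v → ∀ i → y i - x i ≈ t * v i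
        y-x {t} e i = trans (+-congʳ (e i)) (solve 3 (λ x t v → x :+ t :* v :- x := t :* v) refl (x i) t (v i))
        small : ∀ {t} → 0# ≤ t → t < ε * δ → t * ‖ v ‖ < ε
        small {t} 0≤t t<t₀ = ≤-<-trans
          (by-≤ 0≤t (solve 2 (λ t n → t := (n :+ con (+ 1)) :* t :- t :* n) refl t ‖ v ‖))
          (<-resp refl (trans (solve 3 (λ n e d → n :* (e :* d) := e :* (n :* d)) refl (‖ v ‖ + 1#) ε δ)
                       (trans (*-congˡ N*δ≈1) (*-identityʳ ε)))
            (*-monoʳ-< (<-resp refl (+-comm 1# ‖ v ‖) (+-pos-nonNeg 0<1 0≤‖ v ‖)) t<t₀))

  affineFn : Vector ℝ n → ℝ → Vector ℝ n → ℝ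
  affineFn w b x = w · x + b

  opaque

    affineFn-near : (w : Vector ℝ n) (b : ℝ) (x : Vector ℝ n) {ε : ℝ} → 0# < ε →
      Near x (λ z → affineFn w b z - affineFn w b x < ε × affineFn w b x - affineFn w b z < ε)
    affineFn-near w b x {ε} 0<ε with ·-bound w
    ... | c , 0≤c , bound with inverse-pos (<-resp refl (+-comm 1# c) (+-pos-nonNeg 0<1 0≤c))
    ...   | d , 0<d , [c+1]d≈1 = ε * d , *-pos 0<ε 0<d , λ z p →
          <-resp (diff z) refl (≤-<-trans (proj₁ (bound (z ⊖ x) (proj₁ p))) cδ<ε) ,
          <-resp (trans (-‿cong (diff z)) (solve 2 (λ a b → :- (a :- b) := b :- a) refl _ _)) refl
            (≤-<-trans (proj₂ (bound (z ⊖ x) (proj₁ p))) cδ<ε)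
      where
      cδ<ε : c * (ε * d) < ε
      cδ<ε = by-< (*-pos 0<ε 0<d) (sym (trans
        (+-congʳ (trans (sym (*-identityʳ ε)) (*-congˡ (sym [c+1]d≈1))))
        (solve 3 (λ c e d → e :* ((c :+ con (+ 1)) :* d) :- c :* (e :* d) := e :* d) refl c ε d)))
      diff : ∀ z → w · (z ⊖ x) ≈ affineFn w b z - affineFn w b x
      diff z = trans (·-⊖ w z x) (solve 3 (λ a b c → a :- b := a :+ c :- (b :+ c)) refl _ _ b)

    relu-nonNeg : ∀ x → 0# ≤ relu x
    relu-nonNeg x = x≤x⊔y 0# x

    x≤relu : ∀ x → x ≤ relu x
    x≤relu x = x≤y⊔x 0# x

    relu-pos : ∀ {x} → 0# ≤ x → relu x ≈ x
    relu-pos {x} p = antisym (⊔-lub p ≤-refl) (x≤relu x)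

    relu-neg : ∀ {x} → x ≤ 0# → relu x ≈ 0#
    relu-neg {x} p = antisym (⊔-lub ≤-refl p) (relu-nonNeg x)

    -- If `x` is nonnegative the difference can only shrink, because `relu y` is at least `y`. If
    -- `x` is nonpositive it is at most 0, which is where `0# < ε` enters.
    relu-contraction : ∀ {x y ε} → 0# < ε → x - y < ε → relu x - relu y < ε
    relu-contraction {x} {y} 0<ε p with total 0# x
    ... | inj₁ q = ≤-<-trans (by-≤ (≤⇒0≤- (x≤relu y))
          (trans (solve 3 (λ x y z → z :- y := (x :- y) :- (x :- z)) refl x y (relu y))
            (+-congˡ (-‿cong (+-congʳ (sym (relu-pos q))))))) p
    ... | inj₂ q = ≤-<-trans (by-≤ (relu-nonNeg y)
          (trans (solve 1 (λ z → z := con (+ 0) :- (con (+ 0) :- z)) refl (relu y))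
            (+-congˡ (-‿cong (+-congʳ (sym (relu-neg q))))))) 0<ε

  Continuous : (Vector ℝ m → Vector ℝ n) → Set₁
  Continuous F = ∀ x P → Near (F x) P → Near x (F ⊢ P)

  opaque

    σ∘apply-continuous : (A : AffineMap m n) → Continuous (λ x → σ (apply A x))
    σ∘apply-continuous A x P (ε , 0<ε , p) = near-mono (λ {z} q → p _ (‖‖-lub-< 0<ε (λ j →
        relu-contraction 0<ε (proj₁ (q j)) ,
        <-resp (solve 2 (λ a b → a :- b := :- (b :- a)) refl _ _) refl (relu-contraction 0<ε (proj₂ (q j))))))
      (near-∀ (λ j → affineFn-near (weight A j) (bias A j) x 0<ε))

    layerMap-continuous : {a : Architecture k} (L : HiddenLayers a) → Continuous (layerMap L)
    layerMap-continuous []      x P p = p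
    layerMap-continuous (L ▷ A) x P p = layerMap-continuous L x _ (σ∘apply-continuous A (layerMap L x) P p)

  -- No condition is imposed where the reference value a vanishes.
  Agree Agree< : ℝ → ℝ → Set
  Agree  a b = (0# < a → 0# ≤ b) × (a < 0# → b ≤ 0#)
  Agree< a b = (0# < a → 0# < b) × (a < 0# → b < 0#)

  opaque

    -- The absolute value of the function at `x` serves as the tolerance: a change smaller than that
    -- cannot reach 0. Where the value is 0, nothing is demanded.
    affineFn-agree : (w : Vector ℝ n) (b : ℝ) (x : Vector ℝ n) →
                     Near x (λ z → Agree< (affineFn w b x) (affineFn w b z))
    affineFn-agree w b x with compare 0# (affineFn w b x)
    ... | inj₁ 0<ℓ = near-mono (λ {z} p →
            (λ _ → by-< (<⇒0<- (proj₂ p)) (solve 2 (λ x z → x :- (x :- z) := z :- con (+ 0)) refl _ _)) ,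
            (λ ℓ<0 → ⊥-elim (≤⇒≯ (proj₁ 0<ℓ) ℓ<0))) (affineFn-near w b x 0<ℓ)
    ... | inj₂ (inj₁ 0≈ℓ) = near-U (λ z → (λ 0<ℓ → ⊥-elim (<-irrefl 0≈ℓ 0<ℓ)) , λ ℓ<0 → ⊥-elim (<-irrefl (sym 0≈ℓ) ℓ<0))
    ... | inj₂ (inj₂ ℓ<0) = near-mono (λ {z} p → (λ 0<ℓ → ⊥-elim (≤⇒≯ (proj₁ 0<ℓ) ℓ<0)) ,
            (λ _ → by-< (<⇒0<- (proj₁ p)) (solve 2 (λ x z → :- x :- (z :- x) := con (+ 0) :- z) refl _ _)))
            (affineFn-near w b x (neg-pos ℓ<0))

-- Linear algebra: dimension and affine hulls.

module Dimension (em : ∀ {ℓ} → ExcludedMiddle ℓ) (R : RealNumbers) where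
  open Topology em R public

  private variable
    m n k : ℕ

  opaque

    ¬∀⇒∃¬ : {A : Set} {P : A → Set} → ¬ (∀ x → P x) → ∃[ x ] ¬ P x
    ¬∀⇒∃¬ {A} {P} f with em {P = ∃[ x ] ¬ P x}
    ... | yes p = p
    ... | no p  = ⊥-elim (f λ x → case x em)
      where
      case : ∀ x → Dec (P x) → P x
      case x (yes q) = q
      case x (no q)  = ⊥-elim (p (x , q))

    combination-coord : (c : Vector ℝ k) (v : Vector (Vector ℝ n) k) → ∀ l →
                        combination c v l ≈ sum (λ i → c i * v i l)
    combination-coord {zero}  c v l = refl
    combination-coord {suc k} c v l = +-congˡ (combination-coord (tail c) (tail v) l)

    combination-cong : {c c′ : Vector ℝ k} {v v′ : Vector (Vector ℝ n) k} → c ≋ c′ → (∀ i → v i ≋ v′ i) →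
                       combination c v ≋ combination c′ v′
    combination-cong {c = c} {c′} {v} {v′} e f l = trans (combination-coord c v l)
      (trans (sum-cong-≋ (λ i → *-cong (e i) (f i l))) (sym (combination-coord c′ v′ l)))

    combination-zero : {c : Vector ℝ k} {v : Vector (Vector ℝ n) k} → c ≋ 0ᵛ → combination c v ≋ 0ᵛ
    combination-zero {c = c} {v} e l = trans (combination-coord c v l) (sum-zero (λ i → trans (*-congʳ (e i)) (zeroˡ _)))

    combination-⊕ : (c d : Vector ℝ k) (v : Vector (Vector ℝ n) k) →
                    combination (c ⊕ d) v ≋ combination c v ⊕ combination d v
    combination-⊕ c d v l = trans (combination-coord (c ⊕ d) v l)
      (trans (·-distribʳ-⊕ c d (λ i → v i l))
      (+-cong (sym (combination-coord c v l)) (sym (combination-coord d v l))))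

    combination-• : (a : ℝ) (c : Vector ℝ k) (v : Vector (Vector ℝ n) k) →
                    combination (a • c) v ≋ a • combination c v
    combination-• a c v l = trans (combination-coord (a • c) v l)
      (trans (•-· a c (λ i → v i l)) (*-congˡ (sym (combination-coord c v l))))

    combination-combination : (c : Vector ℝ m) (a : Vector (Vector ℝ k) m) (v : Vector (Vector ℝ n) k) →
      combination c (λ i → combination (a i) v) ≋ combination (combination c a) v
    combination-combination {zero}  c a v l = sym (combination-zero {v = v} (λ _ → refl) l)
    combination-combination {suc m} c a v l = trans
      (+-cong (sym (combination-• (head c) (head a) v l)) (combination-combination (tail c) (tail a) v l))
      (sym (combination-⊕ (head c • head a) (combination (tail c) (tail a)) v l))

    sum-affine : (c u : Vector ℝ k) (b : ℝ) → sum (λ i → c i * (b + u i)) ≈ sum c * b + c · u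
    sum-affine c u b = trans
      (sum-cong-≋ (λ i → solve 3 (λ c b u → c :* (b :+ u) := c :* b :+ c :* u) refl (c i) b (u i)))
      (trans (∑-distrib-+ (λ i → c i * b) (λ i → c i * u i)) (+-congʳ (sym (*-distribʳ-sum b c))))

    -- Elimination of one coordinate by a vector that does not vanish there.
    dependent : n ℕ.< k → (v : Vector (Vector ℝ n) k) → ∃[ c ] (¬ (c ≋ 0ᵛ) × combination c v ≋ 0ᵛ)
    dependent {zero}  {suc k} n<k v = (1# ∷ 0ᵛ) , (λ e → 0≉1 (sym (e zero))) , λ ()
    dependent {suc n} {suc k} (s≤s n<k) v with em {P = v zero ≋ 0ᵛ}
    ... | yes v₀≋0 = (1# ∷ 0ᵛ) , (λ e → 0≉1 (sym (e zero))) , λ l →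
            trans (+-cong (trans (*-congˡ (v₀≋0 l)) (zeroʳ 1#)) (combination-zero {v = tail v} (λ _ → refl) l)) (+-identityˡ 0#)
    ... | no v₀≉0 with ¬∀⇒∃¬ v₀≉0
    ...   | i , v₀ᵢ≉0 with inverse (v zero i) v₀ᵢ≉0
    ...     | p , v₀ᵢp≈1 with dependent n<k (λ j l → reduced j (punchIn i l))
      where
      reduced : Vector (Vector ℝ (suc n)) k
      reduced j l = v (suc j) l - (v (suc j) i * p) * v zero l
    -- The relation `c` holds among the vectors with multiples of `v zero` subtracted and coordinate
    -- `i` deleted. The head coefficient collects those multiples; coordinate `i` cancels by the
    -- choice of the pivot inverse `p`.
    ...       | c , c≉0 , comb≋0 = (- (c · u) ∷ c) , (λ e → c≉0 (λ j → e (suc j))) , λ l → vanishes l (i Fin.≟ l)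
      where
      u : Vector ℝ k
      u j = v (suc j) i * p
      eliminate : ∀ l → combination (- (c · u) ∷ c) v l ≈ c · (λ j → v (suc j) l - u j * v zero l)
      eliminate l = trans (+-congˡ (combination-coord c (tail v) l)) (trans
        (solve 3 (λ s x t → :- s :* x :+ t := t :- x :* s) refl (c · u) (v zero l) (c · (λ j → v (suc j) l)))
        (trans (+-congˡ (-‿cong (sym (·-• c (v zero l) u))))
        (trans (sym (·-⊖ c (λ j → v (suc j) l) (v zero l • u)))
          (·-congʳ c (λ j → +-congˡ (-‿cong (*-comm _ _)))))))
      vanishes : ∀ l → Dec (i ≡ l) → combination (- (c · u) ∷ c) v l ≈ 0#
      vanishes l (yes ≡.refl) = trans (eliminate l) (·-zeroʳ c (λ j → trans
        (+-congˡ (-‿cong (trans (solve 3 (λ x p y → x :* p :* y := x :* (y :* p)) refl (v (suc j) i) p (v zero i)) (*-congˡ v₀ᵢp≈1))))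
        (solve 1 (λ x → x :- x :* con (+ 1) := con (+ 0)) refl (v (suc j) i))))
      vanishes l (no i≢l) = ≡.subst (λ l → combination (- (c · u) ∷ c) v l ≈ 0#) (Fin.punchIn-punchOut i≢l)
        (trans (eliminate _) (trans (sym (combination-coord c _ (punchOut i≢l))) (comb≋0 (punchOut i≢l))))

  opaque

    independent-size : {v : Vector (Vector ℝ n) k} → LinearlyIndependent v → k ℕ.≤ n
    independent-size {n} {k} {v} ind with k ℕ.≤? n
    ... | yes p = p
    ... | no p with dependent (ℕ.≰⇒> p) v
    ...   | c , c≉0 , e = ⊥-elim (c≉0 (ind c e))

    -- A relation with nonzero coefficient at `u` could be solved for `u`, which would put `u` in
    -- the span.
    extend-independent : {v : Vector (Vector ℝ n) k} {u : Vector ℝ n} → LinearlyIndependent v →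
                         ¬ (∃[ c ] u ≋ combination c v) → LinearlyIndependent (u ∷ v)
    extend-independent {v = v} {u} ind u∉span c e with ≈? (c zero) 0#
    ... | yes c₀≈0 = λ { zero → c₀≈0 ; (suc i) → ind (tail c) (λ l →
            trans (sym (trans (+-congʳ (trans (*-congʳ c₀≈0) (zeroˡ _))) (+-identityˡ _))) (e l)) i }
    ... | no c₀≉0 = let p , c₀p≈1 = inverse (c zero) c₀≉0 in
      ⊥-elim (u∉span ((- p • tail c) , λ l → trans
        (trans (trans (sym (*-identityˡ _)) (*-congʳ (sym c₀p≈1)))
          (trans (solve 4 (λ c p u r → c :* p :* u := :- p :* r :+ p :* (c :* u :+ r)) refl (c zero) p (u l) (combination (tail c) v l))
            (trans (+-congˡ (trans (*-congˡ (e l)) (zeroʳ p))) (+-identityʳ _))))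
        (sym (combination-• (- p) (tail c) v l))))

    independent-spans : {v : Vector (Vector ℝ n) n} → LinearlyIndependent v → ∀ u → ∃[ c ] u ≋ combination c v
    independent-spans {v = v} ind u with em {P = ∃[ c ] u ≋ combination c v}
    ... | yes p = p
    ... | no p  = ⊥-elim (ℕ.1+n≰n (independent-size {v = u ∷ v} (extend-independent {v = v} ind p)))

  unit : Vector (Vector ℝ n) n
  unit zero    = 1# ∷ 0ᵛ
  unit (suc i) = 0# ∷ unit i

  opaque

    combination-unit : (c : Vector ℝ n) → combination c unit ≋ c
    combination-unit c zero    = trans (+-cong (solve 1 (λ c → c :* con (+ 1) := c) refl (c zero))
      (trans (combination-coord (tail c) (λ i → unit (suc i)) zero) (sum-zero (λ i → zeroʳ (c (suc i)))))) (+-identityʳ _)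
    combination-unit c (suc l) = trans (+-cong (zeroʳ _)
      (trans (combination-coord (tail c) (λ i → unit (suc i)) (suc l)) (sym (combination-coord (tail c) unit l))))
      (trans (+-identityˡ _) (combination-unit (tail c) l))

    -- If `k` were smaller than `n`, the `n` coefficient vectors expressing the unit vectors would
    -- be dependent in dimension `k`, and the same relation would bind the unit vectors.
    spanning-size : (v : Vector (Vector ℝ n) k) → (∀ u → ∃[ c ] u ≋ combination c v) → n ℕ.≤ k
    spanning-size {n} {k} v spans with n ℕ.≤? k
    ... | yes p = p
    ... | no p with dependent (ℕ.≰⇒> p) (λ i → proj₁ (spans (unit i)))
    ...   | c , c≉0 , e = ⊥-elim (c≉0 (≋-trans (≋-sym (combination-unit c))
            (≋-trans (combination-cong {c = c} (λ _ → refl) (λ i → proj₂ (spans (unit i))))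
            (≋-trans (combination-combination c (λ i → proj₁ (spans (unit i))) v) (combination-zero {v = v} e)))))

  -- Working form of having dimension `n`. It lets an affine function that vanishes on `S` be seen
  -- to vanish everywhere, without choosing a basis.
  Full : Subset n → Set
  Full S = ∀ x → x ∈ affineHull S

  opaque

    full⇒dimension : {S : Subset n} → Full S → HasDimension S n
    full⇒dimension full = 0ᵛ , unit , (λ c e → ≋-trans (≋-sym (combination-unit c)) e) ,
      (λ {x} _ → x , λ l → sym (trans (+-identityˡ _) (combination-unit x l))) , λ {x} _ → full x

    dimension⇒full : {S : Subset n} {d : ℕ} → HasDimension S d → n ℕ.≤ d → Full S
    dimension⇒full (p , v , ind , _ , span⊆hull) n≤d x with ℕ.≤-antisym n≤d (independent-size ind)
    ... | ≡.refl = let c , e = independent-spans ind (x ⊖ p) in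
      span⊆hull (c , λ l → trans (solve 2 (λ x p → x := p :+ (x :- p)) refl (x l) (p l)) (+-congˡ (e l)))

    full⇒≤dimension : {S : Subset n} {d : ℕ} → HasDimension S d → Full S → n ℕ.≤ d
    full⇒≤dimension (p , v , ind , hull⊆span , _) full = spanning-size v (λ u →
      let c , e = hull⊆span (full (p ⊕ u)) in
      c , λ l → trans (solve 2 (λ u p → u := :- p :+ (p :+ u)) refl (u l) (p l))
        (trans (+-congˡ (e l)) (solve 2 (λ p r → :- p :+ (p :+ r) := r) refl (p l) _)))

  opaque

    -- Directions from `p` to points of `S` are collected greedily, each outside the span of the
    -- previous ones, until all of `S` is reached.
    hasDimension : (S : Subset n) → Satisfiable S → ∃[ d ] HasDimension S d
    hasDimension {n} S (p , p∈S) = grow n ε ε (λ c _ ()) (λ ()) (λ ()) (ℕ.m≤m+n n 0)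
      where
      -- `f` is fuel. The invariant `n ℕ.≤ f ℕ.+ k` means that, once the fuel is spent, a further
      -- independent direction would exceed the ambient dimension.
      grow : ∀ f {k} (v q : Vector (Vector ℝ n) k) → LinearlyIndependent v → (∀ i → v i ≋ q i ⊖ p) →
             (∀ i → q i ∈ S) → n ℕ.≤ f ℕ.+ k → ∃[ d ] HasDimension S d
      grow f {k} v q ind v≋q-p q∈S n≤f+k with em {P = ∃[ z ] (z ∈ S × ¬ (∃[ c ] z ⊖ p ≋ combination c v))}
      ... | yes (z , z∈S , z∉span) = extend f n≤f+k
        where
        ind′ : LinearlyIndependent (z ⊖ p ∷ v)
        ind′ = extend-independent {v = v} ind z∉span
        extend : ∀ f → n ℕ.≤ f ℕ.+ k → ∃[ d ] HasDimension S d
        extend zero    n≤k = ⊥-elim (ℕ.1+n≰n (ℕ.≤-trans (independent-size {v = z ⊖ p ∷ v} ind′) n≤k))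
        extend (suc f) le  = grow f (z ⊖ p ∷ v) (z ∷ q) ind′
          (λ { zero l → refl ; (suc i) → v≋q-p i }) (λ { zero → z∈S ; (suc i) → q∈S i })
          (ℕ.≤-trans le (ℕ.≤-reflexive (≡.sym (ℕ.+-suc f k))))
      ... | no S⊆span = k , p , v , ind , hull⊆span , span⊆hull
        where
        coefficients : ∀ z → z ∈ S → ∃[ c ] z ⊖ p ≋ combination c v
        coefficients z z∈S with em {P = ∃[ c ] z ⊖ p ≋ combination c v}
        ... | yes r = r
        ... | no r  = ⊥-elim (S⊆span (z , z∈S , r))
        hull⊆span : affineHull S ⊆ affineSpan p v
        hull⊆span {x} (m , r , c , r∈S , sum≈1 , e) = combination c a , λ l → trans (e l) (begin
          combination c r l                            ≈⟨ combination-coord c r l ⟩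
          sum (λ i → c i * r i l)                      ≈⟨ sum-cong-≋ (λ i → *-congˡ {c i} (r-coord i l)) ⟩
          sum (λ i → c i * (p l + combination (a i) v l)) ≈⟨ sum-affine c (λ i → combination (a i) v l) (p l) ⟩
          sum c * p l + sum (λ i → c i * combination (a i) v l)
            ≈⟨ +-cong (trans (*-congʳ sum≈1) (*-identityˡ _)) (sym (combination-coord c (λ i → combination (a i) v) l)) ⟩
          p l + combination c (λ i → combination (a i) v) l ≈⟨ +-congˡ (combination-combination c a v l) ⟩
          p l + combination (combination c a) v l      ∎)
          where
          open import Relation.Binary.Reasoning.Setoid setoid
          a : Vector (Vector ℝ k) m
          a i = proj₁ (coefficients (r i) (r∈S i))
          r-coord : ∀ i l → r i l ≈ p l + combination (a i) v l
          r-coord i l = trans (solve 2 (λ x p → x := p :+ (x :- p)) refl (r i l) (p l))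
            (+-congˡ (proj₂ (coefficients (r i) (r∈S i)) l))
        span⊆hull : affineSpan p v ⊆ affineHull S
        -- The directions are differences `q i ⊖ p`, so the base point receives the weight that
        -- brings the total to 1.
        span⊆hull {x} (c , e) = suc k , (p ∷ q) , (1# - sum c ∷ c) , (λ { zero → p∈S ; (suc i) → q∈S i }) ,
          solve 1 (λ s → con (+ 1) :- s :+ s := con (+ 1)) refl (sum c) , λ l → trans (e l) (begin
          p l + combination c v l                      ≈⟨ +-congˡ (combination-coord c v l) ⟩
          p l + sum (λ i → c i * v i l)                ≈⟨ +-congˡ (sum-cong-≋ (λ i → *-congˡ {c i} (trans (v≋q-p i l) (+-comm _ _)))) ⟩
          p l + sum (λ i → c i * (- p l + q i l))      ≈⟨ +-congˡ (sum-affine c (λ i → q i l) (- p l)) ⟩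
          p l + (sum c * - p l + sum (λ i → c i * q i l)) ≈⟨ +-congˡ (+-congˡ (sym (combination-coord c q l))) ⟩
          p l + (sum c * - p l + combination c q l)
            ≈⟨ solve 3 (λ p s r → p :+ (s :* :- p :+ r) := (con (+ 1) :- s) :* p :+ r) refl (p l) (sum c) (combination c q l) ⟩
          (1# - sum c) * p l + combination c q l       ∎)
          where open import Relation.Binary.Reasoning.Setoid setoid

  opaque

    -- Inverts the homothety with centre `x` and ratio `t`: with `s` the inverse of `t`, the weights
    -- 1 - `s` at `x` and `s` at the intermediate point give back `z`.
    extrapolate : {S : Subset n} {x : Vector ℝ n} (z : Vector ℝ n) (t s : ℝ) → t * s ≈ 1# →
                  x ∈ S → x ⊕ t • (z ⊖ x) ∈ S → z ∈ affineHull S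
    extrapolate {n} {S} {x} z t s ts≈1 x∈S y∈S = 2 , p , c ,
        (λ { zero → x∈S ; (suc zero) → y∈S }) ,
        solve 1 (λ s → con (+ 1) :- s :+ (s :+ con (+ 0)) := con (+ 1)) refl s ,
        λ l → sym (coordinate (x l) (z l))
      where
      p : Vector (Vector ℝ n) 2
      p = x ∷ (x ⊕ t • (z ⊖ x)) ∷ ε
      c : Vector ℝ 2
      c = (1# - s) ∷ s ∷ ε
      coordinate : ∀ a b → (1# - s) * a + (s * (a + t * (b - a)) + 0#) ≈ b
      coordinate a b = trans
        (solve 4 (λ s t x z → (con (+ 1) :- s) :* x :+ (s :* (x :+ t :* (z :- x)) :+ con (+ 0)) := x :+ (t :* s) :* (z :- x))
          refl s t a b)
        (trans (+-congˡ (*-congʳ ts≈1)) (solve 2 (λ x z → x :+ con (+ 1) :* (z :- x) := z) refl a b))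

  opaque

    -- From `x`, a short step towards any `z` stays in `S`, and the line through both ends of that
    -- step reaches `z`.
    near⇒full : {S : Subset n} {x : Vector ℝ n} → Near x S → Full S
    near⇒full {S = S} {x} near z =
      let t₀ , 0<t₀ , on-line = near-line near (z ⊖ x)
          h , 0<h , h<1       = 0<half
          s , _ , ts≈1        = inverse-pos (*-pos 0<t₀ 0<h)
          t<t₀                = <-resp refl (*-identityʳ t₀) (*-monoʳ-< 0<t₀ h<1)
      in extrapolate {S = S} {x} z (t₀ * h) s ts≈1 (near-self near) (on-line (proj₁ (*-pos 0<t₀ 0<h)) t<t₀ (λ _ → refl))

    affineHull-zero : {S : Subset n} (w : Vector ℝ n) (b : ℝ) → (∀ {y} → y ∈ S → affineFn w b y ≈ 0#) →
                      ∀ {x} → x ∈ affineHull S → affineFn w b x ≈ 0#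
    affineHull-zero w b zero-on {x} (k , p , c , p∈S , sum≈1 , e) = begin
      w · x + b
        ≈⟨ +-cong (trans (·-congʳ w e) (·-combination w c p)) (sym (trans (*-congʳ sum≈1) (*-identityˡ b))) ⟩
      c · (λ i → w · p i) + sum c * b      ≈⟨ +-comm _ _ ⟩
      sum c * b + c · (λ i → w · p i)      ≈⟨ sum-affine c (λ i → w · p i) b ⟨
      sum (λ i → c i * (b + w · p i))      ≈⟨ sum-zero (λ i → trans (*-congˡ (trans (+-comm _ _) (zero-on (p∈S i)))) (zeroʳ _)) ⟩
      0#                                   ∎
      where open import Relation.Binary.Reasoning.Setoid setoid

-- Convexity, connectedness, and components of a complement.

module Connectedness (em : ∀ {ℓ} → ExcludedMiddle ℓ) (R : RealNumbers) where
  open Dimension em R public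

  private variable
    m n k : ℕ

  opaque

    0<-below : ∀ {x y} → 0# < x → 0# < y → ∃[ z ] (0# < z × z < x × z < y)
    0<-below p q =
      let z , 0<z , z≤x , z≤y = minimum p q
          h , 0<h , h<1       = 0<half
          zh<z = <-resp refl (*-identityʳ z) (*-monoʳ-< 0<z h<1)
      in z * h , *-pos 0<z 0<h , <-≤-trans zh<z z≤x , <-≤-trans zh<z z≤y

  segment : ℝ → Vector ℝ n → Vector ℝ n → Vector ℝ n
  segment t x z = x ⊕ t • (z ⊖ x)

  Convex : Subset n → Set
  Convex C = ∀ {x z t y} → x ∈ C → z ∈ C → 0# ≤ t → t ≤ 1# → y ≋ segment t x z → y ∈ C

  opaque

    segment-zero : (a b : Vector ℝ n) → segment 0# a b ≋ a
    segment-zero a b i = solve 2 (λ a b → a :+ con (+ 0) :* (b :- a) := a) refl (a i) (b i)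

    segment-one : {t : ℝ} (a b : Vector ℝ n) → t ≈ 1# → segment t a b ≋ b
    segment-one a b e i = trans (+-congˡ (*-congʳ e)) (solve 2 (λ a b → a :+ con (+ 1) :* (b :- a) := b) refl (a i) (b i))

    segment-forward : (s t : ℝ) (a b : Vector ℝ n) → segment t a b ≋ segment s a b ⊕ (t - s) • (b ⊖ a)
    segment-forward s t a b i =
      solve 4 (λ a b s t → a :+ t :* (b :- a) := a :+ s :* (b :- a) :+ (t :- s) :* (b :- a)) refl (a i) (b i) s t

    segment-backward : (s t : ℝ) (a b : Vector ℝ n) → segment t a b ≋ segment s a b ⊕ (s - t) • (a ⊖ b)
    segment-backward s t a b i =
      solve 4 (λ a b s t → a :+ t :* (b :- a) := a :+ s :* (b :- a) :+ (s :- t) :* (a :- b)) refl (a i) (b i) s t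

  opaque

    -- Let `s` be the supremum of the parameters whose point on the segment from `a` to `b` lies in
    -- `V`. If the point at `s` is in `V`, openness gives a larger such parameter unless `s` is 1,
    -- and then `b` lies in both sets. If it is in `W`, so are the points just before it, and one of
    -- those lies in `V`, since otherwise a smaller upper bound would exist.
    convex⇒connected : {C : Subset n} → Convex C → Connected C
    convex⇒connected {n} {C} convex V W V-open W-open C⊆V∪W (a , a∈C , a∈V) (b , b∈C , b∈W)
      with supremum P (0# , 0∈P) (1# , λ p → proj₁ (proj₂ p))
      where
      P : ℝ → Set
      P t = 0# ≤ t × t ≤ 1# × segment t a b ∈ V
      0∈P : P 0#
      0∈P = ≤-refl , proj₁ 0<1 , near-resp {P = V} (segment-zero a b) (V-open a∈V)
    ... | s , s-upper , s-least = [ in-V , in-W ]′ (C⊆V∪W γs∈C)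
      where
      γ : ℝ → Vector ℝ n
      γ t = segment t a b
      0≤s : 0# ≤ s
      0≤s = s-upper (≤-refl , proj₁ 0<1 , near-resp {P = V} (segment-zero a b) (V-open a∈V))
      s≤1 : s ≤ 1#
      s≤1 = s-least (λ p → proj₁ (proj₂ p))
      γs∈C : γ s ∈ C
      γs∈C = convex a∈C b∈C 0≤s s≤1 (λ _ → refl)
      in-V : γ s ∈ V → Satisfiable (C ∩ (V ∩ W))
      in-V γs∈V with ≈? s 1# | near-line {x = γ s} {P = V} (V-open {γ s} γs∈V) (b ⊖ a)
      ... | yes s≈1 | _ = b , b∈C , near-resp {P = V} (≋-sym (segment-one a b s≈1)) (V-open γs∈V) , b∈W
      ... | no s≉1 | t₀ , 0<t₀ , on-line with 0<-below 0<t₀ (<⇒0<- (s≤1 , s≉1))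
      ...   | δ , 0<δ , δ<t₀ , δ<1-s = ⊥-elim (≤⇒≯ (s-upper (≤-trans 0≤s (proj₁ s<s+δ) ,
                by-≤ (≤⇒0≤- (proj₁ δ<1-s)) (solve 2 (λ s d → con (+ 1) :- s :- d := con (+ 1) :- (s :+ d)) refl s δ) ,
                on-line (≤⇒0≤- (proj₁ s<s+δ)) (<-resp δ≈s+δ-s refl δ<t₀) (segment-forward s (s + δ) a b))) s<s+δ)
        where
        δ≈s+δ-s : δ ≈ s + δ - s
        δ≈s+δ-s = solve 2 (λ s d → d := s :+ d :- s) refl s δ
        s<s+δ : s < s + δ
        s<s+δ = by-< 0<δ δ≈s+δ-s
      in-W : γ s ∈ W → Satisfiable (C ∩ (V ∩ W))
      in-W γs∈W with near-line {x = γ s} {P = W} (W-open {γ s} γs∈W) (a ⊖ b)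
      ... | t₀ , 0<t₀ , on-line with em {P = ∃[ t ] (0# ≤ t × t ≤ 1# × γ t ∈ V × s - t₀ < t)}
      ...   | yes (t , 0≤t , t≤1 , γt∈V , close) =
                γ t , convex a∈C b∈C 0≤t t≤1 (λ _ → refl) , γt∈V ,
                on-line (≤⇒0≤- (s-upper (0≤t , t≤1 , γt∈V)))
                  (by-< (<⇒0<- close) (solve 3 (λ s t u → t :- (s :- u) := u :- (s :- t)) refl s t t₀))
                  (segment-backward s t a b)
      ...   | no far = ⊥-elim (≤⇒≯ (s-least (λ {t} (0≤t , t≤1 , γt∈V) → ≮⇒≥ (λ q → far (t , 0≤t , t≤1 , γt∈V , q))))
                (by-< 0<t₀ (solve 2 (λ s u → u := s :- (s :- u)) refl s t₀)))

  -- Sign regions of a family of functions whose nonzero signs are locally stable.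

  module Regions {n : ℕ} {I : Set} (f : I → Vector ℝ n → ℝ)
                 (f-agree : ∀ i x → Near x (λ z → Agree< (f i x) (f i z)))
                 (B : Subset n) (B≐zeros : B ≐ (λ x → ∃[ i ] f i x ≈ 0#)) where

    -- For `x` off `B` these become the component of `x` and its closure. The family is instantiated
    -- both with the rows of one layer and with the nodes of all layers.
    Region WeakRegion : Vector ℝ n → Subset n
    Region     x z = ∀ i → Agree< (f i x) (f i z)
    WeakRegion x z = ∀ i → Agree  (f i x) (f i z)

    opaque

      off : ∀ {x} → x ∈ ∁ B → ∀ i → f i x < 0# ⊎ 0# < f i x
      off {x} x∉B i with compare (f i x) 0#
      ... | inj₁ p        = inj₁ p
      ... | inj₂ (inj₁ e) = ⊥-elim (x∉B (proj₂ B≐zeros (i , e)))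
      ... | inj₂ (inj₂ p) = inj₂ p

      region-self : ∀ x → x ∈ Region x
      region-self x i = (λ p → p) , λ p → p

      region-trans : ∀ {x y z} → y ∈ Region x → z ∈ Region y → z ∈ Region x
      region-trans p q i = (λ r → proj₁ (q i) (proj₁ (p i) r)) , λ r → proj₂ (q i) (proj₂ (p i) r)

      region⊆weak : ∀ {x} → Region x ⊆ WeakRegion x
      region⊆weak p i = (λ q → proj₁ (proj₁ (p i) q)) , λ q → proj₁ (proj₂ (p i) q)

      region-resp : ∀ {x y z} → z ∈ Region x → y ≋ z → y ∈ Region x
      region-resp {x} {y} {z} p e = region-trans p (λ i → near-resp {P = λ y → Agree< (f i z) (f i y)} e (f-agree i z))

      region⊆∁B : ∀ {x} → x ∈ ∁ B → Region x ⊆ ∁ B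
      region⊆∁B x∉B z∈ z∈B with proj₁ B≐zeros z∈B
      ... | i , fz≈0 = [ (λ p → <-irrefl fz≈0 (proj₂ (z∈ i) p)) , (λ p → <-irrefl (sym fz≈0) (proj₁ (z∈ i) p)) ]′ (off x∉B i)

      weak∩∁B⊆region : ∀ {x z} → z ∈ WeakRegion x → z ∈ ∁ B → z ∈ Region x
      weak∩∁B⊆region {x} {z} z∈ z∉B i =
        (λ p → [ (λ q → ⊥-elim (≤⇒≯ (proj₁ (z∈ i) p) q)) , (λ q → q) ]′ (off z∉B i)) ,
        (λ p → [ (λ q → q) , (λ q → ⊥-elim (≤⇒≯ (proj₂ (z∈ i) p) q)) ]′ (off z∉B i))

      weak-change : ∀ {x y} → x ∈ ∁ B → y ∈ Region x → WeakRegion x ≐ WeakRegion y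
      weak-change {x} {y} x∉B y∈ =
        (λ z∈ i → [ (λ p → (λ q → ⊥-elim (≤⇒≯ (proj₁ (proj₂ (y∈ i) p)) q)) , λ _ → proj₂ (z∈ i) p)
                  , (λ p → (λ _ → proj₁ (z∈ i) p) , λ q → ⊥-elim (≤⇒≯ (proj₁ (proj₁ (y∈ i) p)) q)) ]′ (off x∉B i)) ,
        (λ z∈ i → (λ p → proj₁ (z∈ i) (proj₁ (y∈ i) p)) , λ p → proj₂ (z∈ i) (proj₂ (y∈ i) p))

      positive-open : ∀ i → Open (λ x → 0# < f i x)
      positive-open i {x} p = near-mono (λ {z} q → proj₁ q p) (f-agree i x)

      negative-open : ∀ i → Open (λ x → f i x < 0#)
      negative-open i {x} p = near-mono (λ {z} q → proj₂ q p) (f-agree i x)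

      -- If some `f i` took both signs on `K`, its positive and negative sets would be disjoint open
      -- sets that cover `K` and both meet it.
      connected⊆region : ∀ {K x} → K ⊆ ∁ B → Connected K → x ∈ K → K ⊆ Region x
      connected⊆region {K} {x} K⊆∁B connected x∈K {z} z∈K i =
        (λ p → [ (λ q → ⊥-elim (clash x∈K p z∈K q)) , (λ q → q) ]′ (off (K⊆∁B z∈K) i)) ,
        (λ p → [ (λ q → q) , (λ q → ⊥-elim (clash z∈K q x∈K p)) ]′ (off (K⊆∁B z∈K) i))
        where
        clash : ∀ {x z} → x ∈ K → 0# < f i x → z ∈ K → f i z < 0# → ⊥
        clash x∈K p z∈K q with connected (λ x → 0# < f i x) (λ x → f i x < 0#) (positive-open i) (negative-open i)
          (λ y∈K → [ inj₂ , inj₁ ]′ (off (K⊆∁B y∈K) i)) (_ , x∈K , p) (_ , z∈K , q)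
        ... | _ , _ , r , r′ = ≤⇒≯ (proj₁ r) r′

    -- `star` says that going from `x` towards a point with weakly the same signs keeps the signs
    -- strict until the end. It gives the convexity of regions and the density of a region in its
    -- weak version.
    module Components (star : ∀ {x z t y} → x ∈ ∁ B → z ∈ WeakRegion x → 0# ≤ t → t < 1# →
                              y ≋ segment t x z → y ∈ Region x) where

      opaque

        region-convex : ∀ {x} → x ∈ ∁ B → Convex (Region x)
        region-convex x∉B {z} {z′} {t} {y} z∈ z′∈ 0≤t t≤1 e with ≈? t 1#
        -- The starting point `z` takes over as reference point, which is legitimate because `z` is
        -- off `B` and has the same weak region. The endpoint, which `star` excludes, is `z′`
        -- itself.
        ... | no t≉1  = region-trans z∈ (star (region⊆∁B x∉B z∈)
                (proj₁ (weak-change x∉B z∈) (region⊆weak z′∈)) 0≤t (t≤1 , t≉1) e)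
        ... | yes t≈1 = region-resp z′∈ (λ i → trans (e i) (trans (+-congˡ (*-congʳ t≈1))
                (solve 2 (λ a b → a :+ con (+ 1) :* (b :- a) := b) refl (z i) (z′ i))))

        region-component : ∀ {x} → x ∈ ∁ B → ConnectedComponent (∁ B) (Region x)
        region-component {x} x∉B = (x , region-self x) , region⊆∁B x∉B , convex⇒connected (region-convex x∉B) ,
          λ K K⊆∁B connected region⊆K → connected⊆region K⊆∁B connected (region⊆K (region-self x))

        component-region : ∀ {K x} → ConnectedComponent (∁ B) K → x ∈ K → K ≐ Region x
        component-region {K} {x} (_ , K⊆∁B , connected , maximal) x∈K =
          K⊆region , maximal (Region x) (region⊆∁B (K⊆∁B x∈K)) (convex⇒connected (region-convex (K⊆∁B x∈K))) K⊆region
          where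
          K⊆region : K ⊆ Region x
          K⊆region = connected⊆region K⊆∁B connected x∈K

        closure-region : ∀ {x} → x ∈ ∁ B → closure (Region x) ≐ WeakRegion x
        closure-region {x} x∉B = closed , dense
          where
          closed : closure (Region x) ⊆ WeakRegion x
          closed {z} z∈ i with f-agree i z
          ... | ε , 0<ε , near with z∈ ε 0<ε
          ...   | y , y∈ , ‖y-z‖<ε =
            (λ p → ≮⇒≥ (λ q → ≤⇒≯ (proj₁ (proj₁ (y∈ i) p)) (proj₂ (near y ‖y-z‖<ε) q))) ,
            (λ p → ≮⇒≥ (λ q → ≤⇒≯ (proj₁ (proj₂ (y∈ i) p)) (proj₁ (near y ‖y-z‖<ε) q)))
          dense : WeakRegion x ⊆ closure (Region x)
          dense {z} z∈ ε 0<ε with near-line {x = z} {P = λ y → ‖ y ⊖ z ‖ < ε} (ε , 0<ε , λ y q → q) (x ⊖ z)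
          ... | t₀ , 0<t₀ , on-line with 0<-below 0<t₀ 0<1
          -- Near `z` but slightly towards `x`: seen from `x` this is the point at parameter 1 -
          -- `t`, below 1 as `star` requires.
          ...   | t , 0<t , t<t₀ , t<1 = z ⊕ t • (x ⊖ z) ,
                  star {t = 1# - t} x∉B z∈ (≤⇒0≤- (proj₁ t<1))
                    (by-< 0<t (solve 1 (λ t → t := con (+ 1) :- (con (+ 1) :- t)) refl t))
                    (λ i → solve 3 (λ t x z → z :+ t :* (x :- z) := x :+ (con (+ 1) :- t) :* (z :- x)) refl t (x i) (z i)) ,
                  on-line (proj₁ 0<t) t<t₀ (λ _ → refl)

        component-closure : ∀ {K x} → ConnectedComponent (∁ B) K → x ∈ K → closure K ≐ WeakRegion x
        component-closure {K} {x} comp@(_ , K⊆∁B , _) x∈K =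
          (λ z∈ → proj₁ (closure-region (K⊆∁B x∈K)) (closure-mono (proj₁ K≐) z∈)) ,
          (λ z∈ → closure-mono (proj₂ K≐) (proj₂ (closure-region (K⊆∁B x∈K)) z∈))
          where
          K≐ : K ≐ Region x
          K≐ = component-region comp x∈K
          closure-mono : {S T : Subset n} → S ⊆ T → closure S ⊆ closure T
          closure-mono S⊆T z∈ ε 0<ε = let y , y∈S , q = z∈ ε 0<ε in y , S⊆T y∈S , q

-- Cells of the hyperplane arrangement of a single layer.

module Arrangements (em : ∀ {ℓ} → ExcludedMiddle ℓ) (R : RealNumbers) where
  open Connectedness em R public

  private variable
    m n k : ℕ

  opaque

    affineFn-segment : (w : Vector ℝ n) (b t : ℝ) (x z : Vector ℝ n) {y : Vector ℝ n} → y ≋ segment t x z →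
                       affineFn w b y ≈ (1# - t) * affineFn w b x + t * affineFn w b z
    affineFn-segment w b t x z e = trans
      (+-congʳ (trans (·-congʳ w e) (trans (·-distribˡ-⊕ w x (t • (z ⊖ x)))
        (+-congˡ (trans (·-• w t (z ⊖ x)) (*-congˡ (·-⊖ w z x)))))))
      (solve 4 (λ p q b t → p :+ t :* (q :- p) :+ b := (con (+ 1) :- t) :* (p :+ b) :+ t :* (q :+ b)) refl (w · x) (w · z) b t)

    affineFn-line : (w : Vector ℝ n) (b t : ℝ) (x v : Vector ℝ n) →
                    affineFn w b (x ⊕ t • v) ≈ affineFn w b x + t * (w · v)
    affineFn-line w b t x v = trans (+-congʳ (trans (·-distribˡ-⊕ w x (t • v)) (+-congˡ (·-• w t v))))
      (solve 3 (λ p q b → p :+ q :+ b := p :+ b :+ q) refl (w · x) (t * (w · v)) b)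

    affineFn-neg : (w : Vector ℝ n) (b : ℝ) (x : Vector ℝ n) → affineFn (- 1# • w) (- b) x ≈ - affineFn w b x
    affineFn-neg w b x = trans (+-congʳ (•-· (- 1#) w x))
      (solve 2 (λ p b → :- con (+ 1) :* p :+ :- b := :- (p :+ b)) refl (w · x) b)

    neg-weight≉0 : {w : Vector ℝ n} → ¬ (w ≋ 0ᵛ) → ¬ (- 1# • w ≋ 0ᵛ)
    neg-weight≉0 {w = w} w≉0 e = w≉0 (λ i → trans (solve 1 (λ w → w := :- (:- con (+ 1) :* w)) refl (w i))
      (trans (-‿cong (e i)) -0≈0))

    convexity-pos : ∀ {t a b c} → 0# ≤ t → t < 1# → c ≈ (1# - t) * a + t * b → 0# < a → 0# ≤ b → 0# < c
    convexity-pos 0≤t t<1 e p q = <-resp refl (sym e) (+-pos-nonNeg (*-pos (<⇒0<- t<1) p) (*-nonNeg 0≤t q))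

    convexity-neg : ∀ {t a b c} → 0# ≤ t → t < 1# → c ≈ (1# - t) * a + t * b → a < 0# → b ≤ 0# → c < 0#
    convexity-neg {t} {a} {b} 0≤t t<1 e p q = <-resp (sym e) refl
      (by-< (+-pos-nonNeg (*-pos (<⇒0<- t<1) (neg-pos p)) (*-nonNeg 0≤t (neg-nonNeg q)))
        (solve 3 (λ t a b → (con (+ 1) :- t) :* :- a :+ t :* :- b := con (+ 0) :- ((con (+ 1) :- t) :* a :+ t :* b)) refl t a b))

    convexity-agree : ∀ {t a b c} → 0# ≤ t → t < 1# → c ≈ (1# - t) * a + t * b → Agree a b → Agree< a c
    convexity-agree 0≤t t<1 e (p , q) =
      (λ 0<a → convexity-pos 0≤t t<1 e 0<a (p 0<a)) , λ a<0 → convexity-neg 0≤t t<1 e a<0 (q a<0)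

    convexity-nonNeg : ∀ {t a b c} → 0# ≤ t → t ≤ 1# → c ≈ (1# - t) * a + t * b → 0# ≤ a → 0# ≤ b → 0# ≤ c
    convexity-nonNeg 0≤t t≤1 e p q = ≤-resp refl (sym e) (+-nonNeg (*-nonNeg (≤⇒0≤- t≤1) p) (*-nonNeg 0≤t q))

    convexity-nonPos : ∀ {t a b c} → 0# ≤ t → t ≤ 1# → c ≈ (1# - t) * a + t * b → a ≤ 0# → b ≤ 0# → c ≤ 0#
    convexity-nonPos {t} {a} {b} 0≤t t≤1 e p q = ≤-resp (sym e) refl
      (by-≤ (+-nonNeg (*-nonNeg (≤⇒0≤- t≤1) (neg-nonNeg p)) (*-nonNeg 0≤t (neg-nonNeg q)))
        (solve 3 (λ t a b → (con (+ 1) :- t) :* :- a :+ t :* :- b := con (+ 0) :- ((con (+ 1) :- t) :* a :+ t :* b)) refl t a b))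

    convexity-zero : ∀ {t a b c} → c ≈ (1# - t) * a + t * b → a ≈ 0# → b ≈ 0# → c ≈ 0#
    convexity-zero {t} e p q = trans e (trans (+-cong (*-congˡ p) (*-congˡ q))
      (solve 1 (λ t → (con (+ 1) :- t) :* con (+ 0) :+ t :* con (+ 0) := con (+ 0)) refl t))

    -- Finitely many open dense sets meet densely: intersecting `V` with the first one leaves a
    -- nonempty open set on which to continue.
    generic-point : (P : Fin k → Subset n) → (∀ j → Open (P j)) →
                    (∀ j V → Open V → Satisfiable V → Satisfiable (V ∩ P j)) →
                    (V : Subset n) → Open V → Satisfiable V → ∃[ z ] (z ∈ V × (∀ j → z ∈ P j))
    generic-point {zero}  P P-open P-dense V V-open (z , z∈V) = z , z∈V , λ ()
    generic-point {suc k} P P-open P-dense V V-open V-sat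
      with generic-point (λ j → P (suc j)) (λ j → P-open (suc j)) (λ j → P-dense (suc j))
      (V ∩ P zero) (λ { (p , q) → near-∩ (V-open p) (P-open zero q) }) (P-dense zero V V-open V-sat)
    ... | z , (z∈V , z∈P₀) , z∈P = z , z∈V , λ { zero → z∈P₀ ; (suc j) → z∈P j }

  SignDefinite : Subset n → (Vector ℝ n → ℝ) → Set
  SignDefinite C f = (∀ {z} → z ∈ C → 0# ≤ f z) ⊎ (∀ {z} → z ∈ C → f z ≤ 0#)

  ≐-trans : {A B C : Subset n} → A ≐ B → B ≐ C → A ≐ C
  ≐-trans (p , q) (r , s) = (λ x → r (p x)) , λ x → q (s x)

  ≐-sym : {A B : Subset n} → A ≐ B → B ≐ A
  ≐-sym (p , q) = q , p

  face-resp : {P C D : Subset n} → C ≐ D → IsFace P C → IsFace P D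
  face-resp e (inj₁ p)                         = inj₁ (≐-trans (≐-sym e) p)
  face-resp e (inj₂ (inj₁ p))                  = inj₂ (inj₁ (≐-trans (≐-sym e) p))
  face-resp e (inj₂ (inj₂ (w , b , sup , p))) = inj₂ (inj₂ (w , b , sup , ≐-trans (≐-sym e) p))

  face-⊆ : {P C : Subset n} → IsFace P C → C ⊆ P
  face-⊆ (inj₁ (p , _)) z∈ = ⊥-elim (p z∈)
  face-⊆ (inj₂ (inj₁ (p , _))) z∈ = p z∈
  face-⊆ (inj₂ (inj₂ (_ , _ , _ , p , _))) z∈ = proj₁ (p z∈)

  module Arrangement {m n : ℕ} (A : AffineMap m n) where

    preactivation : Fin n → Vector ℝ m → ℝ
    preactivation j = affineFn (weight A j) (bias A j)

    open Regions {I = Σ (Fin n) (Nondegenerate A)} (λ i → preactivation (proj₁ i))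
      (λ i → affineFn-agree (weight A (proj₁ i)) (bias A (proj₁ i)))
      (⋃ _ (arrangement A)) ((λ p → p) , λ p → p) public

    opaque

      near-region : ∀ x → Near x (Region x)
      near-region x = near-mono (λ { p (j , _) → p j }) (near-∀ (λ j → affineFn-agree (weight A j) (bias A j) x))

      region-open : ∀ x → Open (Region x)
      region-open x {z} z∈ = near-mono (λ {u} u∈ → region-trans {x} {z} {u} z∈ u∈) (near-region z)

    open Components (λ {x} {z} {t} {y} _ z∈ 0≤t t<1 e i →
      convexity-agree 0≤t t<1 (affineFn-segment (weight A (proj₁ i)) (bias A (proj₁ i)) t x z e) (z∈ i)) public

    private
      B : Subset m
      B = ⋃ _ (arrangement A)

    Cell : Subset m → Set₁
    Cell Y = Y ∈ arrangementComplex (arrangement A)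

    opaque

      weak-cell : ∀ {x} → x ∈ ∁ B → Cell (WeakRegion x)
      weak-cell {x} x∉B = Region x , region-component x∉B , inj₂ (inj₁ (≐-sym (closure-region x∉B)))

      cell-component : ∀ {Y} → Cell Y → ∃[ x ] (x ∈ ∁ B × ∃[ K ] (closure K ≐ WeakRegion x × IsFace (closure K) Y))
      cell-component (K , comp@((x , x∈K) , K⊆∁B , _) , face) = x , K⊆∁B x∈K , K , component-closure comp x∈K , face

      weak-convex : ∀ {x} → Convex (WeakRegion x)
      weak-convex {x} {z} {z′} {t} {y} z∈ z′∈ 0≤t t≤1 e i =
        (λ p → convexity-nonNeg 0≤t t≤1 ℓ (proj₁ (z∈ i) p) (proj₁ (z′∈ i) p)) ,
        (λ p → convexity-nonPos 0≤t t≤1 ℓ (proj₂ (z∈ i) p) (proj₂ (z′∈ i) p))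
        where
        ℓ : preactivation (proj₁ i) y ≈ (1# - t) * preactivation (proj₁ i) z + t * preactivation (proj₁ i) z′
        ℓ = affineFn-segment (weight A (proj₁ i)) (bias A (proj₁ i)) t z z′ e

    opaque

      cell-convex : ∀ {Y} → Cell Y → Convex Y
      cell-convex {Y} cell {z} {z′} {t} {y} z∈ z′∈ 0≤t t≤1 e with cell-component cell
      ... | x , x∉B , K , K≐ , face = by-face face
        where
        y∈K : y ∈ closure K
        y∈K = proj₂ K≐ (weak-convex (proj₁ K≐ (face-⊆ face z∈)) (proj₁ K≐ (face-⊆ face z′∈)) 0≤t t≤1 e)
        by-face : IsFace (closure K) Y → y ∈ Y
        by-face (inj₁ (p , _))        = ⊥-elim (p z∈)
        by-face (inj₂ (inj₁ (_ , q))) = q y∈K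
        by-face (inj₂ (inj₂ (w , b , _ , p , q))) =
          q (y∈K , convexity-zero (affineFn-segment w b t z z′ e) (proj₂ (p z∈)) (proj₂ (p z′∈)))

    opaque

      -- A degenerate row is constant, with the sign of its bias. For any other row the cell lies in
      -- the weak region of some `x` where the row is nonzero, and takes over that sign.
      cell-sign : ∀ {Y} → Cell Y → ∀ j → SignDefinite Y (preactivation j)
      cell-sign {Y} cell j with em {P = weight A j ≋ 0ᵛ} | cell-component cell
      ... | yes w≋0 | _ with total 0# (bias A j)
      ...   | inj₁ p = inj₁ (λ {z} _ → ≤-resp refl (sym (trans (+-congʳ (·-zeroˡ z w≋0)) (+-identityˡ _))) p)
      ...   | inj₂ p = inj₂ (λ {z} _ → ≤-resp (sym (trans (+-congʳ (·-zeroˡ z w≋0)) (+-identityˡ _))) refl p)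
      cell-sign {Y} cell j | no w≉0 | x , x∉B , K , K≐ , face with off x∉B (j , w≉0)
      ... | inj₁ p = inj₂ (λ z∈ → proj₂ (proj₁ K≐ (face-⊆ face z∈) (j , w≉0)) p)
      ... | inj₂ p = inj₁ (λ z∈ → proj₁ (proj₁ K≐ (face-⊆ face z∈) (j , w≉0)) p)

    opaque

      -- Off the hyperplanes the closed region is a neighbourhood of `y`. A proper face through `y`
      -- is impossible: a short step along the outer normal `w` of its supporting hyperplane would
      -- stay in the region and yet leave the half-space.
      cell-off : ∀ {Y y} → Cell Y → y ∈ Y → y ∈ ∁ B → Y ≐ WeakRegion y
      cell-off {Y} {y} cell y∈ y∉B with cell-component cell
      ... | x , x∉B , K , K≐ , face = by-face face
        where
        closure≐ : closure K ≐ WeakRegion y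
        closure≐ = ≐-trans K≐ (weak-change x∉B (weak∩∁B⊆region (proj₁ K≐ (face-⊆ face y∈)) y∉B))
        by-face : IsFace (closure K) Y → Y ≐ WeakRegion y
        by-face (inj₁ (p , _))  = ⊥-elim (p y∈)
        by-face (inj₂ (inj₁ p)) = ≐-trans p closure≐
        by-face (inj₂ (inj₂ (w , b , (w≉0 , ≤0 , _) , p , _))) with near-line (near-region y) w
        ... | t₀ , 0<t₀ , on-line with 0<-below 0<t₀ 0<t₀
        ...   | t , 0<t , t<t₀ , _ = ⊥-elim (≤⇒≯
                (≤0 (proj₂ closure≐ (region⊆weak (on-line (proj₁ 0<t) t<t₀ (λ _ → refl)))))
                (<-resp refl (sym (trans (affineFn-line w b t y w) (trans (+-congʳ (proj₂ (p y∈))) (+-identityˡ _))))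
                  (*-pos 0<t (0<w·w w≉0))))

    opaque

      -- `y` is perturbed within its open sign region to a point `x` on no hyperplane. Nonzero signs
      -- at `y` survive at `x`, so a row that is positive at `x` cannot be negative at `y`, and
      -- conversely.
      cover : ∀ y → ∃[ x ] (x ∈ ∁ B × y ∈ WeakRegion x)
      cover y
        with generic-point Nonvanishing Nonvanishing-open Nonvanishing-dense (Region y) (region-open y) (y , region-self y)
        where
        Nonvanishing : Fin n → Subset m
        Nonvanishing j x = Nondegenerate A j → ¬ (preactivation j x ≈ 0#)
        Nonvanishing-open : ∀ j → Open (Nonvanishing j)
        Nonvanishing-open j {x} x∈ with em {P = weight A j ≋ 0ᵛ}
        ... | yes w≋0 = near-U (λ z w≉0 → ⊥-elim (w≉0 w≋0))
        ... | no w≉0 with compare 0# (preactivation j x)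
        ...   | inj₁ p        = near-mono (λ q _ e → <-irrefl (sym e) (proj₁ q p)) (affineFn-agree (weight A j) (bias A j) x)
        ...   | inj₂ (inj₁ e) = ⊥-elim (x∈ w≉0 (sym e))
        ...   | inj₂ (inj₂ p) = near-mono (λ q _ e → <-irrefl e (proj₂ q p)) (affineFn-agree (weight A j) (bias A j) x)
        Nonvanishing-dense : ∀ j V → Open V → Satisfiable V → Satisfiable (V ∩ Nonvanishing j)
        Nonvanishing-dense j V V-open (x , x∈V) with em {P = x ∈ Nonvanishing j}
        ... | yes p = x , x∈V , p
        ... | no x∉ with near-line {P = V} (V-open x∈V) (weight A j)
        ...   | t₀ , 0<t₀ , on-line with 0<-below 0<t₀ 0<t₀
        -- If the row vanishes at `x`, a step `t` along its own normal gives it the value `t` times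
        -- the squared length of the normal, which is positive.
        ...     | t , 0<t , t<t₀ , _ = x ⊕ t • weight A j , on-line (proj₁ 0<t) t<t₀ (λ _ → refl) , λ w≉0 e →
                  x∉ (λ _ fx≈0 → <-irrefl (sym (trans (sym (trans (affineFn-line (weight A j) (bias A j) t x (weight A j))
                    (trans (+-congʳ fx≈0) (+-identityˡ _)))) e)) (*-pos 0<t (0<w·w w≉0)))
      ... | x , x∈ , x-nonZero = x , (λ { ((j , w≉0) , e) → x-nonZero j w≉0 e }) , λ i →
            (λ p → ≮⇒≥ (λ q → ≤⇒≯ (proj₁ p) (proj₂ (x∈ i) q))) , λ p → ≮⇒≥ (λ q → ≤⇒≯ (proj₁ (proj₁ (x∈ i) q)) p)

    opaque

      -- The hyperplane of row `i` touches the closure of a region adjacent to `y`, so it cuts out a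
      -- face through `y`. `Supporting` asks for values at most 0, hence the negated normal when the
      -- region lies on the positive side.
      cover-zero : ∀ y (i : Σ (Fin n) (Nondegenerate A)) → preactivation (proj₁ i) y ≈ 0# →
                   ∃[ Y ] (Cell Y × y ∈ Y × (∀ {z} → z ∈ Y → preactivation (proj₁ i) z ≈ 0#))
      cover-zero y (j , w≉0) fy≈0 with cover y
      ... | x , x∉B , y∈ = closure (Region x) ∩ arrangement A (j , w≉0) ,
            (Region x , region-component x∉B , inj₂ (inj₂ supporting)) , (y∈K , fy≈0) , proj₂
        where
        y∈K : y ∈ closure (Region x)
        y∈K = proj₂ (closure-region x∉B) y∈
        on-closure : ∀ {z} → z ∈ closure (Region x) → Agree (preactivation j x) (preactivation j z)
        on-closure z∈ = proj₁ (closure-region x∉B) z∈ (j , w≉0)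
        neg : ∀ z → affineFn (- 1# • weight A j) (- bias A j) z ≈ - preactivation j z
        neg = affineFn-neg (weight A j) (bias A j)
        to : ∀ {z} → preactivation j z ≈ 0# → affineFn (- 1# • weight A j) (- bias A j) z ≈ 0#
        to e = trans (neg _) (trans (-‿cong e) -0≈0)
        from : ∀ {z} → affineFn (- 1# • weight A j) (- bias A j) z ≈ 0# → preactivation j z ≈ 0#
        from {z} e = trans (solve 1 (λ a → a := :- (:- a)) refl (preactivation j z))
          (trans (-‿cong (trans (sym (neg z)) e)) -0≈0)
        supporting : ∃[ w ] ∃[ b ] (Supporting (closure (Region x)) w b ×
                       closure (Region x) ∩ arrangement A (j , w≉0) ≐ closure (Region x) ∩ hyperplane w b)
        supporting with off x∉B (j , w≉0)
        ... | inj₁ p = weight A j , bias A j , (w≉0 , (λ z∈ → proj₂ (on-closure z∈) p) , y , y∈K , fy≈0) ,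
                       (λ q → q) , λ q → q
        ... | inj₂ p = - 1# • weight A j , - bias A j , (neg-weight≉0 w≉0 ,
                         (λ z∈ → ≤-resp (sym (neg _)) refl (neg-nonPos (proj₁ (on-closure z∈) p))) , y , y∈K , to fy≈0) ,
                       (λ { (z∈ , e) → z∈ , to e }) , λ { (z∈ , e) → z∈ , from e }

-- Cells and sign regions of the composed layers.

module Layers (em : ∀ {ℓ} → ExcludedMiddle ℓ) (R : RealNumbers) where
  open Arrangements em R public

  private variable
    m n k n₀ : ℕ
    a : Architecture n₀

  AffineOn : Subset n → (Vector ℝ n → ℝ) → Set
  AffineOn C f = ∃[ w ] ∃[ b ] (∀ {z} → z ∈ C → f z ≈ affineFn w b z)

  opaque

    affineOn-⊆ : {C D : Subset n} {f : Vector ℝ n → ℝ} → D ⊆ C → AffineOn C f → AffineOn D f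
    affineOn-⊆ D⊆C (w , b , e) = w , b , λ z∈ → e (D⊆C z∈)

    signDefinite-⊆ : {C D : Subset n} {f : Vector ℝ n → ℝ} → D ⊆ C → SignDefinite C f → SignDefinite D f
    signDefinite-⊆ D⊆C (inj₁ p) = inj₁ (λ z∈ → p (D⊆C z∈))
    signDefinite-⊆ D⊆C (inj₂ p) = inj₂ (λ z∈ → p (D⊆C z∈))

    signDefinite-∘ : {D : Subset n} {f : Vector ℝ n → ℝ} (F : Vector ℝ m → Vector ℝ n) →
                     SignDefinite D f → SignDefinite (F ⊢ D) (λ x → f (F x))
    signDefinite-∘ F (inj₁ p) = inj₁ (λ z∈ → p z∈)
    signDefinite-∘ F (inj₂ p) = inj₂ (λ z∈ → p z∈)

    affineOn-∘ : {C : Subset n} {g : Vector ℝ n → Vector ℝ k} → (∀ l → AffineOn C (λ x → g x l)) →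
                 (w : Vector ℝ k) (b : ℝ) → AffineOn C (λ x → affineFn w b (g x))
    affineOn-∘ {k = zero}  aff w b = 0ᵛ , b , λ {z} _ → +-congʳ (sym (·-zeroˡ z (λ _ → refl)))
    affineOn-∘ {k = suc k} aff w b =
      let u , c , e  = aff zero
          u′ , c′ , e′ = affineOn-∘ (λ l → aff (suc l)) (tail w) b
      in w zero • u ⊕ u′ , w zero * c + c′ , λ {z} z∈ → trans
        (solve 3 (λ p q b → p :+ q :+ b := p :+ (q :+ b)) refl _ _ b)
        (trans (+-cong (*-congˡ (e z∈)) (e′ z∈))
        (trans (solve 5 (λ w p c q d → w :* (p :+ c) :+ (q :+ d) := w :* p :+ q :+ (w :* c :+ d))
            refl (w zero) (u · z) c (u′ · z) c′)
          (+-congʳ (sym (trans (·-distribʳ-⊕ (w zero • u) u′ z) (+-congʳ (•-· (w zero) u z)))))))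

    affineOn-segment : {C : Subset n} {f : Vector ℝ n → ℝ} {t : ℝ} {x z y : Vector ℝ n} → AffineOn C f →
                       x ∈ C → z ∈ C → y ∈ C → y ≋ segment t x z → f y ≈ (1# - t) * f x + t * f z
    affineOn-segment {t = t} {x} {z} (w , b , e) x∈ z∈ y∈ y≋ = trans (e y∈)
      (trans (affineFn-segment w b t x z y≋) (+-cong (*-congˡ (sym (e x∈))) (*-congˡ (sym (e z∈)))))

    unit-· : (x : Vector ℝ n) → ∀ l → unit l · x ≈ x l
    unit-· x zero    = trans (+-cong (*-identityˡ _) (·-zeroˡ (tail x) (λ _ → refl))) (+-identityʳ _)
    unit-· x (suc l) = trans (+-cong (zeroˡ _) (unit-· (tail x) l)) (+-identityˡ _)

  -- Rows of zero weight are left out, as they are in `layersBent`, so that zeros of nodes and the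
  -- bent arrangement coincide.
  Node : HiddenLayers {n₀} a → Set
  Node []                  = ⊥
  Node (_▷_ {n = n} L A) = Node L ⊎ Σ (Fin n) (Nondegenerate A)

  nodeMap : (L : HiddenLayers {n₀} a) → Node L → Vector ℝ n₀ → ℝ
  nodeMap (L ▷ A) (inj₁ i)       x = nodeMap L i x
  nodeMap (L ▷ A) (inj₂ (j , _)) x = Arrangement.preactivation A j (layerMap L x)

  opaque

    nodeMap-agree : (L : HiddenLayers {n₀} a) → ∀ i x → Near x (λ z → Agree< (nodeMap L i x) (nodeMap L i z))
    nodeMap-agree (L ▷ A) (inj₁ i)       x = nodeMap-agree L i x
    nodeMap-agree (L ▷ A) (inj₂ (j , _)) x =
      layerMap-continuous L x _ (affineFn-agree (weight A j) (bias A j) (layerMap L x))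

    bent≐zeros : (L : HiddenLayers {n₀} a) → layersBent L ≐ (λ x → ∃[ i ] nodeMap L i x ≈ 0#)
    bent≐zeros []      = (λ ()) , λ ()
    bent≐zeros (L ▷ A) =
      [ (λ p → let i , e = proj₁ (bent≐zeros L) p in inj₁ i , e) , (λ { (i , e) → inj₂ i , e }) ]′ ,
      λ { (inj₁ i , e) → inj₁ (proj₂ (bent≐zeros L) (i , e)) ; (inj₂ i , e) → inj₂ (i , e) }

  module LayerRegions {n₀ : ℕ} {a : Architecture n₀} (L : HiddenLayers a) =
    Regions {I = Node L} (nodeMap L) (nodeMap-agree L) (layersBent L) (bent≐zeros L)

  open LayerRegions public using (Region; WeakRegion)

  CellOf : HiddenLayers {n₀} a → Subset n₀ → Set₁
  CellOf L C = C ∈ layerComplex L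

  opaque

    near-region : (L : HiddenLayers {n₀} a) → ∀ x → Near x (Region L x)
    near-region []      x = near-U (λ _ ())
    near-region (L ▷ A) x = near-mono (λ { (p , q) (inj₁ i) → p i ; (p , q) (inj₂ i) → q i })
      (near-∩ (near-region L x) (layerMap-continuous L x _ (Arrangement.near-region A (layerMap L x))))

    region-open : (L : HiddenLayers {n₀} a) → ∀ x → Open (Region L x)
    region-open L x {z} z∈ = near-mono (λ {u} u∈ → LayerRegions.region-trans L {x} {z} {u} z∈ u∈) (near-region L z)

    layerComplex-resp : (L : HiddenLayers {n₀} a) {C D : Subset n₀} → C ≐ D → CellOf L C → CellOf L D
    layerComplex-resp []            e (lift (inj₁ p)) = lift (inj₁ (≐-trans (≐-sym e) p))
    layerComplex-resp []            e (lift (inj₂ p)) = lift (inj₂ (≐-trans (≐-sym e) p))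
    layerComplex-resp ([] ▷ A)      e (K , comp , face) = K , comp , face-resp e face
    layerComplex-resp (_ ▷ _ ▷ A)   e (S , Y , S∈ , Y∈ , p) = S , Y , S∈ , Y∈ , ≐-trans (≐-sym e) p

  opaque

    -- Gives the first layer, whose complex is defined without an intersection, the shape of the
    -- later ones by taking the whole space for `S`, so that inductions need no separate case.
    cell-split : (L : HiddenLayers {n₀} a) .{{_ : ℕ.NonZero n}} (A : AffineMap (width a) n) {C : Subset n₀} → CellOf (L ▷ A) C →
                 ∃[ S ] ∃[ Y ] (CellOf L S × Arrangement.Cell A Y × C ≐ S ∩ (layerMap L ⊢ Y))
    cell-split []      A {C} C∈ = U , C , lift (inj₂ ((λ p → p) , λ p → p)) , C∈ , (λ p → tt , p) , proj₂
    cell-split (_ ▷ _) A C∈ = C∈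

    -- With no earlier layer the cells are the empty set and the whole space; satisfiability of `S`
    -- selects the latter, and the join is then `Y` itself.
    cell-join : (L : HiddenLayers {n₀} a) .{{_ : ℕ.NonZero n}} (A : AffineMap (width a) n)
                {S : Subset n₀} {Y : Subset (width a)} →
                Satisfiable S → CellOf L S → Arrangement.Cell A Y → CellOf (L ▷ A) (S ∩ (layerMap L ⊢ Y))
    cell-join []      A (x , x∈S) (lift (inj₁ (p , _))) _ = ⊥-elim (p x∈S)
    cell-join []      A _ (lift (inj₂ (_ , U⊆S))) (K , comp , face) =
      K , comp , face-resp ((λ p → U⊆S tt , p) , proj₂) face
    cell-join (_ ▷ _) A {S} {Y} _ S∈ Y∈ = S , Y , S∈ , Y∈ , (λ p → p) , λ p → p

  opaque

    -- Both claims need a single induction: the preimage of `Y` within `S` is convex because the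
    -- earlier layers are affine on `S`, and ReLU preserves affineness because each preactivation
    -- keeps one sign on `Y`.
    cell-convex-affine : (L : HiddenLayers {n₀} a) {C : Subset n₀} → CellOf L C →
                         Convex C × (∀ l → AffineOn C (λ x → layerMap L x l))
    cell-convex-affine [] {C} (lift C∈) = convex C∈ ,
      λ l → unit l , 0# , λ {z} _ → sym (trans (+-identityʳ _) (unit-· z l))
      where
      convex : C ≐ ∅ ⊎ C ≐ U → Convex C
      convex (inj₁ (p , _)) x∈ = ⊥-elim (p x∈)
      convex (inj₂ (_ , q)) _ _ _ _ _ = q tt
    cell-convex-affine (L ▷ A) {C} C∈ with cell-split L A C∈
    ... | S , Y , S∈ , Y∈ , C≐ with cell-convex-affine L S∈
    ...   | S-convex , S-affine = convex , affine-coordinate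
      where
      convex : Convex C
      convex {x} {z} {t} {y} x∈ z∈ 0≤t t≤1 e = proj₂ C≐ (y∈S ,
          Arrangement.cell-convex A Y∈ (proj₂ (proj₁ C≐ x∈)) (proj₂ (proj₁ C≐ z∈)) 0≤t t≤1 λ l → trans
            (affineOn-segment (S-affine l) (proj₁ (proj₁ C≐ x∈)) (proj₁ (proj₁ C≐ z∈)) y∈S e)
            (solve 3 (λ t p q → (con (+ 1) :- t) :* p :+ t :* q := p :+ t :* (q :- p)) refl t _ _))
        where
        y∈S : y ∈ S
        y∈S = S-convex (proj₁ (proj₁ C≐ x∈)) (proj₁ (proj₁ C≐ z∈)) 0≤t t≤1 e
      affine-coordinate : ∀ j → AffineOn C (λ x → layerMap (L ▷ A) x j)
      affine-coordinate j with Arrangement.cell-sign A Y∈ j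
      ... | inj₁ p = let w , b , e = affineOn-∘ S-affine (weight A j) (bias A j) in
              w , b , λ z∈ → trans (relu-pos (p (proj₂ (proj₁ C≐ z∈)))) (e (proj₁ (proj₁ C≐ z∈)))
      ... | inj₂ p = 0ᵛ , 0# , λ {z} z∈ → trans (relu-neg (p (proj₂ (proj₁ C≐ z∈))))
              (sym (trans (+-identityʳ _) (·-zeroˡ z (λ _ → refl))))

  opaque

    preactivation-affine : (L : HiddenLayers {n₀} a) (A : AffineMap (width a) n) {C : Subset n₀} → CellOf L C →
                           ∀ j → AffineOn C (λ x → Arrangement.preactivation A j (layerMap L x))
    preactivation-affine L A C∈ j = affineOn-∘ (proj₂ (cell-convex-affine L C∈)) (weight A j) (bias A j)

  opaque

    nodeMap-affine : (L : HiddenLayers {n₀} a) {C : Subset n₀} → CellOf L C → ∀ i → AffineOn C (nodeMap L i)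
    nodeMap-affine (L ▷ A) C∈ i with cell-split L A C∈
    nodeMap-affine (L ▷ A) C∈ (inj₁ i)       | S , Y , S∈ , Y∈ , C≐ =
      affineOn-⊆ (λ z∈ → proj₁ (proj₁ C≐ z∈)) (nodeMap-affine L S∈ i)
    nodeMap-affine (L ▷ A) C∈ (inj₂ (j , _)) | S , Y , S∈ , Y∈ , C≐ =
      affineOn-⊆ (λ z∈ → proj₁ (proj₁ C≐ z∈)) (preactivation-affine L A S∈ j)

  opaque

    nodeMap-sign : (L : HiddenLayers {n₀} a) {C : Subset n₀} → CellOf L C → ∀ i → SignDefinite C (nodeMap L i)
    nodeMap-sign (L ▷ A) C∈ i with cell-split L A C∈
    nodeMap-sign (L ▷ A) C∈ (inj₁ i)       | S , Y , S∈ , Y∈ , C≐ =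
      signDefinite-⊆ (λ z∈ → proj₁ (proj₁ C≐ z∈)) (nodeMap-sign L S∈ i)
    nodeMap-sign (L ▷ A) C∈ (inj₂ (j , _)) | S , Y , S∈ , Y∈ , C≐ =
      signDefinite-⊆ (λ z∈ → proj₂ (proj₁ C≐ z∈)) (signDefinite-∘ (layerMap L) (Arrangement.cell-sign A Y∈ j))

  opaque

    weakRegion-▷ : (L : HiddenLayers {n₀} a) .{{_ : ℕ.NonZero n}} (A : AffineMap (width a) n) (x : Vector ℝ n₀) →
                   WeakRegion L x ∩ (layerMap L ⊢ Arrangement.WeakRegion A (layerMap L x)) ≐ WeakRegion (L ▷ A) x
    weakRegion-▷ L A x =
      (λ { (p , q) (inj₁ i) → p i ; (p , q) (inj₂ i) → q i }) , λ p → (λ i → p (inj₁ i)) , λ i → p (inj₂ i)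

    weak-self : (L : HiddenLayers {n₀} a) (x : Vector ℝ n₀) → x ∈ WeakRegion L x
    weak-self L x = LayerRegions.region⊆weak L {x} {x} (LayerRegions.region-self L x)

  opaque

    weakRegion-cell : (L : HiddenLayers {n₀} a) (x : Vector ℝ n₀) → x ∈ ∁ (layersBent L) → CellOf L (WeakRegion L x)
    weakRegion-cell []      x x∉B = lift (inj₂ ((λ _ → tt) , λ _ ()))
    weakRegion-cell (L ▷ A) x x∉B = layerComplex-resp (L ▷ A)
      {WeakRegion L x ∩ (layerMap L ⊢ Arrangement.WeakRegion A (layerMap L x))} {WeakRegion (L ▷ A) x}
      (weakRegion-▷ L A x)
      (cell-join L A {WeakRegion L x} {Arrangement.WeakRegion A (layerMap L x)}
        (x , weak-self L x) (weakRegion-cell L x (λ p → x∉B (inj₁ p)))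
        (Arrangement.weak-cell A {layerMap L x} (λ p → x∉B (inj₂ p))))

  opaque

    -- The weak region of `x` is a cell, hence it contains the segment and every node is affine
    -- along it; a strict sign at `x` then outweighs a weak one at `z`.
    star : (L : HiddenLayers {n₀} a) → ∀ {x z t y} → x ∈ ∁ (layersBent L) → z ∈ WeakRegion L x → 0# ≤ t → t < 1# →
           y ≋ segment t x z → y ∈ Region L x
    star L {x} {z} {t} {y} x∉B z∈ 0≤t t<1 e i = convexity-agree 0≤t t<1
      (affineOn-segment (nodeMap-affine L C∈ i) x∈ z∈ (proj₁ (cell-convex-affine L C∈) x∈ z∈ 0≤t (proj₁ t<1) e) e) (z∈ i)
      where
      C∈ : CellOf L (WeakRegion L x)
      C∈ = weakRegion-cell L x x∉B
      x∈ : x ∈ WeakRegion L x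
      x∈ = weak-self L x

  opaque

    -- The point `x` forces both factors: the cell of the earlier layers by induction, and the cell
    -- of the last arrangement by `Arrangement.cell-off` at the image of `x`.
    cell-off : (L : HiddenLayers {n₀} a) {C : Subset n₀} {x : Vector ℝ n₀} → CellOf L C → x ∈ C → x ∈ ∁ (layersBent L) →
               C ≐ WeakRegion L x
    cell-off []      (lift (inj₁ (p , _))) x∈ _ = ⊥-elim (p x∈)
    cell-off []      (lift (inj₂ (_ , q))) _ _  = (λ _ ()) , λ _ → q tt
    cell-off (L ▷ A) {C} {x} C∈ x∈ x∉B with cell-split L A C∈
    ... | S , Y , S∈ , Y∈ , C≐ =
          (λ z∈ → λ { (inj₁ i) → proj₁ S≐ (proj₁ (proj₁ C≐ z∈)) i ; (inj₂ i) → proj₁ Y≐ (proj₂ (proj₁ C≐ z∈)) i }) ,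
          λ z∈ → proj₂ C≐ (proj₂ S≐ (λ i → z∈ (inj₁ i)) , proj₂ Y≐ (λ i → z∈ (inj₂ i)))
      where
      S≐ : S ≐ WeakRegion L x
      S≐ = cell-off L S∈ (proj₁ (proj₁ C≐ x∈)) (λ p → x∉B (inj₁ p))
      Y≐ : Y ≐ Arrangement.WeakRegion A (layerMap L x)
      Y≐ = Arrangement.cell-off A Y∈ (proj₂ (proj₁ C≐ x∈)) (λ p → x∉B (inj₂ p))

  opaque

    cell-cover : (L : HiddenLayers {n₀} a) → ∀ x → ∃[ C ] (CellOf L C × x ∈ C)
    cell-cover []      x = U , lift (inj₂ ((λ p → p) , λ p → p)) , tt
    cell-cover (L ▷ A) x with cell-cover L x | Arrangement.cover A (layerMap L x)
    ... | S , S∈ , x∈S | y , y∉B , Fx∈ = _ , cell-join L A (x , x∈S) S∈ (Arrangement.weak-cell A y∉B) , x∈S , Fx∈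

  opaque

    -- The layer containing node `i` contributes a face on which the node vanishes. All other
    -- factors are arbitrary cells through `x`, and intersecting with them preserves the vanishing.
    cell-cover-zero : (L : HiddenLayers {n₀} a) → ∀ x i → nodeMap L i x ≈ 0# →
                      ∃[ C ] (CellOf L C × x ∈ C × (∀ {z} → z ∈ C → nodeMap L i z ≈ 0#))
    cell-cover-zero (L ▷ A) x (inj₁ i) e with cell-cover-zero L x i e | Arrangement.cover A (layerMap L x)
    ... | S , S∈ , x∈S , S-zero | y , y∉B , Fx∈ =
          _ , cell-join L A (x , x∈S) S∈ (Arrangement.weak-cell A y∉B) , (x∈S , Fx∈) , λ p → S-zero (proj₁ p)
    cell-cover-zero (L ▷ A) x (inj₂ i) e with cell-cover L x | Arrangement.cover-zero A (layerMap L x) i e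
    ... | S , S∈ , x∈S | Y , Y∈ , Fx∈ , Y-zero =
          _ , cell-join L A (x , x∈S) S∈ Y∈ , (x∈S , Fx∈) , λ p → Y-zero (proj₂ p)

-- Consequences of transversality, and the theorem.

module Transversality (em : ∀ {ℓ} → ExcludedMiddle ℓ) (R : RealNumbers) where
  open Layers em R public

  private variable
    m n k n₀ : ℕ
    a : Architecture n₀

  opaque

    -- Along v with w · v ≈ 1 the difference quotient of f is 0, not 1.
    zero⇒¬surjective : {f : Vector ℝ n → ℝ} {S : Subset n} {x : Vector ℝ n} → Near x (λ y → Near y S) →
                       (∀ {z} → z ∈ S → f z ≈ 0#) → ¬ SurjectiveDifferential f S x
    zero⇒¬surjective {n} {f} {S} {x} near f≈0 (w , differential , surjective) with surjective 1#
    -- With `ε` the inverse of `‖ v ‖ + 1#`, the error permitted at `x ⊕ t • v` is at most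
    -- `ε * (t * ‖ v ‖)`, less than `t`, while the actual error is `t`.
    ... | v , _ , w·v≈1 with inverse-pos (<-resp refl (+-comm 1# ‖ v ‖) (+-pos-nonNeg 0<1 0≤‖ v ‖))
    ...   | ε , 0<ε , Nε≈1 with differential ε 0<ε
    ...     | δ , 0<δ , close with near-line {P = λ y → ‖ y ⊖ x ‖ < δ × Near y S} (near-∩ (δ , 0<δ , λ y q → q) near) v
    ...       | t₀ , 0<t₀ , on-line with 0<-below 0<t₀ 0<t₀
    ...         | t , 0<t , t<t₀ , _ = ≤⇒≯ t≤εt‖v‖ εt‖v‖<t
      where
      y : Vector ℝ n
      y = x ⊕ t • v
      y-near : ‖ y ⊖ x ‖ < δ × Near y S
      y-near = on-line (proj₁ 0<t) t<t₀ (λ _ → refl)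
      -- The differential is tested only at points of `relInt S`; the hypothesis that `S` is a
      -- neighbourhood of every point near `x` supplies them.
      y∈relInt : y ∈ relInt S
      y∈relInt = let ε′ , 0<ε′ , p = proj₂ y-near in near-self (proj₂ y-near) , ε′ , 0<ε′ , λ z _ → p z
      y-x : ∀ i → y i - x i ≈ t * v i
      y-x i = solve 3 (λ x t v → x :+ t :* v :- x := t :* v) refl (x i) t (v i)
      increment : ℝ
      increment = (f y - f x) - w · (y ⊖ x)
      increment≈-t : - increment ≈ t
      increment≈-t = trans (-‿cong (+-cong (+-cong (f≈0 (proj₁ y∈relInt)) (-‿cong (f≈0 (near-self (near-self near)))))
        (-‿cong (trans (·-congʳ w y-x) (trans (·-• w t v) (trans (*-congˡ w·v≈1) (*-identityʳ t)))))))
        (solve 1 (λ t → :- ((con (+ 0) :- con (+ 0)) :- t) := t) refl t)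
      ‖y-x‖≤ : ‖ y ⊖ x ‖ ≤ t * ‖ v ‖
      ‖y-x‖≤ = ‖‖-lub (*-nonNeg (proj₁ 0<t) 0≤‖ v ‖) (λ i →
        ≤-resp (sym (y-x i)) refl (*-monoʳ-≤ (proj₁ 0<t) (x≤‖x‖ v i)) ,
        ≤-resp (trans (solve 2 (λ t v → t :* :- v := :- (t :* v)) refl t (v i)) (-‿cong (sym (y-x i)))) refl
          (*-monoʳ-≤ (proj₁ 0<t) (-x≤‖x‖ v i)))
      t≤εt‖v‖ : t ≤ ε * (t * ‖ v ‖)
      t≤εt‖v‖ = ≤-trans (≤-resp increment≈-t refl (x≤y⊔x increment (- increment)))
        (≤-trans (close y y∈relInt (proj₁ y-near)) (*-monoʳ-≤ (proj₁ 0<ε) ‖y-x‖≤))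
      εt‖v‖<t : ε * (t * ‖ v ‖) < t
      εt‖v‖<t = by-< (*-pos 0<ε 0<t) (sym (trans
        (+-congʳ (trans (sym (*-identityʳ t)) (*-congˡ (sym Nε≈1))))
        (solve 3 (λ t n e → t :* ((n :+ con (+ 1)) :* e) :- e :* (t :* n) := e :* t) refl t ‖ v ‖ ε)))

    -- An affine combination of no points would have coefficient sum 0 instead of 1.
    full⇒satisfiable : {C : Subset n} → Full C → Satisfiable C
    full⇒satisfiable full with full 0ᵛ
    ... | zero  , _ , _ , _   , 0≈1 , _ = ⊥-elim (0≉1 0≈1)
    ... | suc _ , p , _ , p∈C , _   , _ = p zero , p∈C zero

  midpoint : Vector ℝ n → Vector ℝ n → Vector ℝ n
  midpoint = segment (proj₁ 0<half)

  -- Membership of one endpoint suffices, so replacing a point by a midpoint keeps every property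
  -- already gained. This is what lets `common-point` collect finitely many of them.
  Absorbing : Subset n → Subset n → Set
  Absorbing C Q = ∀ {x z} → x ∈ C → z ∈ C → x ∈ Q ⊎ z ∈ Q → midpoint x z ∈ Q

  opaque

    convex-midpoint : {C : Subset n} → Convex C → ∀ {x z} → x ∈ C → z ∈ C → midpoint x z ∈ C
    convex-midpoint convex x∈ z∈ = let _ , 0<h , h<1 = 0<half in convex x∈ z∈ (proj₁ 0<h) (proj₁ h<1) (λ _ → refl)

    nonZero-absorbing : {C : Subset n} {f : Vector ℝ n → ℝ} → Convex C → AffineOn C f → SignDefinite C f →
                        Absorbing C (λ x → ¬ (f x ≈ 0#))
    nonZero-absorbing {C = C} {f} convex affine-f sign {x} {z} x∈ z∈ = nonZero sign
      where
      h : ℝ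
      h = proj₁ 0<half
      0<h : 0# < h
      0<h = proj₁ (proj₂ 0<half)
      h<1 : h < 1#
      h<1 = proj₂ (proj₂ 0<half)
      1-h<1 : 1# - h < 1#
      1-h<1 = by-< 0<h (solve 1 (λ h → h := con (+ 1) :- (con (+ 1) :- h)) refl h)
      mix : f (midpoint x z) ≈ (1# - h) * f x + h * f z
      mix = affineOn-segment affine-f x∈ z∈ (convex-midpoint convex x∈ z∈) (λ _ → refl)
      -- The same combination with the endpoints exchanged, since the convexity lemmas expect the
      -- strict sign at the first one.
      mix′ : f (midpoint x z) ≈ (1# - (1# - h)) * f z + (1# - h) * f x
      mix′ = trans mix (solve 3 (λ h a b → (con (+ 1) :- h) :* a :+ h :* b := (con (+ 1) :- (con (+ 1) :- h)) :* b :+ (con (+ 1) :- h) :* a)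
        refl h (f x) (f z))
      nonZero : SignDefinite C f → ¬ (f x ≈ 0#) ⊎ ¬ (f z ≈ 0#) → ¬ (f (midpoint x z) ≈ 0#)
      nonZero (inj₁ 0≤f) (inj₁ x≉0) e =
        <-irrefl (sym e) (convexity-pos (proj₁ 0<h) h<1 mix (0≤f x∈ , λ q → x≉0 (sym q)) (0≤f z∈))
      nonZero (inj₁ 0≤f) (inj₂ z≉0) e =
        <-irrefl (sym e) (convexity-pos (≤⇒0≤- (proj₁ h<1)) 1-h<1 mix′ (0≤f z∈ , λ q → z≉0 (sym q)) (0≤f x∈))
      nonZero (inj₂ f≤0) (inj₁ x≉0) e =
        <-irrefl e (convexity-neg (proj₁ 0<h) h<1 mix (f≤0 x∈ , x≉0) (f≤0 z∈))
      nonZero (inj₂ f≤0) (inj₂ z≉0) e =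
        <-irrefl e (convexity-neg (≤⇒0≤- (proj₁ h<1)) 1-h<1 mix′ (f≤0 z∈ , z≉0) (f≤0 x∈))

    common-point : {C Q : Subset n} {P : Fin k → Subset n} → Convex C → Absorbing C Q → (∀ j → Absorbing C (P j)) →
                   Satisfiable (C ∩ Q) → (∀ j → Satisfiable (C ∩ P j)) → ∃[ z ] (z ∈ C × z ∈ Q × (∀ j → z ∈ P j))
    common-point {k = zero}  convex absQ absP (z , z∈C , z∈Q) satP = z , z∈C , z∈Q , λ ()
    common-point {k = suc k} {P = P} convex absQ absP satQ satP =
      let u , u∈C , u∈P = satP zero
          z , z∈C , z∈Q , z∈P = common-point {P = λ j → P (suc j)} convex absQ (λ j → absP (suc j)) satQ (λ j → satP (suc j))
      in midpoint z u , convex-midpoint convex z∈C u∈C , absQ z∈C u∈C (inj₁ z∈Q) ,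
         λ { zero → absP zero z∈C u∈C (inj₂ u∈P) ; (suc j) → absP (suc j) z∈C u∈C (inj₁ (z∈P j)) }

  opaque

    -- `S` is the weak region of `x` and contains its strict region, which is open and so a
    -- neighbourhood of each of its points.
    near-near-cell : (L : HiddenLayers {n₀} a) {S : Subset n₀} {x : Vector ℝ n₀} → CellOf L S → x ∈ S → x ∈ ∁ (layersBent L) →
                     Near x (λ y → Near y S)
    near-near-cell L {S} {x} S∈ x∈S x∉B = near-mono
      (λ {y} y∈ → near-mono (λ z∈ → proj₂ S≐ (LayerRegions.region⊆weak L z∈)) (region-open L x y∈)) (near-region L x)
      where
      S≐ : S ≐ WeakRegion L x
      S≐ = cell-off L S∈ x∈S x∉B

    -- Around `x` the cell `S` is a neighbourhood, so it has dimension `n₀`, at least 1, and `x` is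
    -- in its relative interior. Vanishing on `S` would make `x` a zero at which the differential is
    -- not surjective.
    transversal-nonZero : .{{_ : NonZero n₀}} (L : HiddenLayers {n₀} a) (A : AffineMap (width a) n) (j : Fin n) →
                          TransversalNetworkThreshold (network L (row A j)) 0# →
                          {S : Subset n₀} {x : Vector ℝ n₀} → CellOf L S → x ∈ S → x ∈ ∁ (layersBent L) →
                          ¬ (∀ {z} → z ∈ S → Arrangement.preactivation A j (layerMap L z) ≈ 0#)
    transversal-nonZero {n₀} L A j (transverse , _) {S} {x} S∈ x∈S x∉B f≈0 =
      zero⇒¬surjective near f≈0
        (transverse S n₀ S∈ (full⇒dimension {S = S} (near⇒full near-S)) (ℕ.>-nonZero⁻¹ n₀) x x∈relInt (f≈0 x∈S))
      where
      near : Near x (λ y → Near y S)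
      near = near-near-cell L S∈ x∈S x∉B
      near-S : Near x S
      near-S = near-self near
      x∈relInt : x ∈ relInt S
      x∈relInt = x∈S , proj₁ near-S , proj₁ (proj₂ near-S) , λ y _ → proj₂ (proj₂ near-S) y

  opaque

    -- `C` is separate from `S` so that it stays fixed while the induction passes to cells of fewer
    -- layers; these contain `C` but are only known to be larger. The point that the induction
    -- yields off the earlier layers is the place where transversality of the new nodes is applied.
    full-meets-complement : .{{_ : NonZero n₀}} (L : HiddenLayers {n₀} a) → TransversalLayers L →
                            {S C : Subset n₀} → CellOf L S → C ⊆ S → Convex C → Full C →
                            ∃[ z ] (z ∈ C × z ∈ ∁ (layersBent L))
    full-meets-complement []      _ {C = C} _ _ _ full = let z , z∈C = full⇒satisfiable {C = C} full in z , z∈C , λ ()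
    full-meets-complement {n₀} (_▷_ {n = n} L A) (transversal-L , transversal-A) {S} {C} S∈ C⊆S convex full
      with cell-split L A S∈
    ... | T , Y , T∈ , Y∈ , S≐ with full-meets-complement L transversal-L T∈ (λ z∈ → proj₁ (proj₁ S≐ (C⊆S z∈))) convex full
    ...   | x , x∈C , x∉B = conclusion
      where
      C⊆T : C ⊆ T
      C⊆T z∈ = proj₁ (proj₁ S≐ (C⊆S z∈))
      f : Fin n → Vector ℝ n₀ → ℝ
      f j z = Arrangement.preactivation A j (layerMap L z)
      f-affine : ∀ j → AffineOn T (f j)
      f-affine = preactivation-affine L A T∈
      f-sign : ∀ j → SignDefinite C (f j)
      f-sign j = signDefinite-⊆ (λ z∈ → proj₂ (proj₁ S≐ (C⊆S z∈))) (signDefinite-∘ (layerMap L) (Arrangement.cell-sign A Y∈ j))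
      f-nonZero : ∀ j → Satisfiable (C ∩ (λ z → ¬ (f j z ≈ 0#)))
      f-nonZero j with em {P = Satisfiable (C ∩ (λ z → ¬ (f j z ≈ 0#)))}
      ... | yes p = p
      -- On `T` the node agrees with one affine function. If that vanishes on `C`, whose affine hull
      -- is everything, it vanishes on all of `T`, hence around `x`.
      ... | no p  = ⊥-elim (transversal-nonZero L A j (transversal-A j) T∈ (C⊆T x∈C) x∉B (λ {z} z∈T →
              trans (e z∈T) (affineHull-zero {S = C} w b (λ y∈C → trans (sym (e (C⊆T y∈C))) (f≈0 y∈C)) (full z))))
        where
        w : Vector ℝ n₀
        w = proj₁ (f-affine j)
        b : ℝ
        b = proj₁ (proj₂ (f-affine j))
        e : ∀ {z} → z ∈ T → f j z ≈ affineFn w b z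
        e = proj₂ (proj₂ (f-affine j))
        f≈0 : ∀ {z} → z ∈ C → f j z ≈ 0#
        f≈0 {z} z∈C with ≈? (f j z) 0#
        ... | yes q = q
        ... | no q  = ⊥-elim (p (z , z∈C , q))
      complement-absorbing : Absorbing C (∁ (layersBent L))
      complement-absorbing x∈ z∈ x∉⊎z∉ y∈B with proj₁ (bent≐zeros L) y∈B
      ... | i , fy≈0 = nonZero-absorbing convex
              (affineOn-⊆ C⊆T (nodeMap-affine L T∈ i)) (signDefinite-⊆ C⊆T (nodeMap-sign L T∈ i)) x∈ z∈
              ([ (λ p → inj₁ (λ e → p (proj₂ (bent≐zeros L) (i , e))))
               , (λ p → inj₂ (λ e → p (proj₂ (bent≐zeros L) (i , e)))) ]′ x∉⊎z∉) fy≈0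
      conclusion : ∃[ z ] (z ∈ C × z ∈ ∁ (layersBent (L ▷ A)))
      conclusion = let z , z∈C , z∉B , z-nonZero = common-point convex complement-absorbing
                         (λ j → nonZero-absorbing convex (affineOn-⊆ C⊆T (f-affine j)) (f-sign j))
                         (x , x∈C , x∉B) f-nonZero
        in z , z∈C , λ { (inj₁ p) → z∉B p ; (inj₂ ((j , _) , p)) → z-nonZero j p }

  opaque

    cell-off-full : (L : HiddenLayers {n₀} a) {C : Subset n₀} {x : Vector ℝ n₀} →
                    CellOf L C → x ∈ C → x ∈ ∁ (layersBent L) → Full C
    cell-off-full L C∈ x∈C x∉B = near⇒full (near-self (near-near-cell L C∈ x∈C x∉B))

    full-cell-meets-complement : .{{_ : NonZero n₀}} (L : HiddenLayers {n₀} a) → TransversalLayers L →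
                                 {C : Subset n₀} {d : ℕ} → CellOf L C → HasDimension C d → n₀ ℕ.≤ d →
                                 ∃[ z ] (z ∈ C × z ∈ ∁ (layersBent L))
    full-cell-meets-complement L transversal {C} C∈ dim n₀≤d =
      full-meets-complement L transversal C∈ (λ p → p) (proj₁ (cell-convex-affine L C∈)) (dimension⇒full {S = C} dim n₀≤d)

    -- A zero of a node lies in a cell on which the node vanishes identically. Such a cell has no
    -- point off the arrangement, so it cannot be full-dimensional.
    bent⊆skeleton : .{{_ : NonZero n₀}} (L : HiddenLayers {n₀} a) → TransversalLayers L →
                    layersBent L ⊆ domain (skeleton (n₀ ∸ 1) (layerComplex L))
    bent⊆skeleton {n₀} L transversal {x} x∈B with proj₁ (bent≐zeros L) x∈B
    ... | i , fx≈0 with cell-cover-zero L x i fx≈0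
    ...   | C , C∈ , x∈C , f≈0 with hasDimension C (x , x∈C)
    ...     | d , dim = C , (C∈ , inj₂ (d , ℕ.∸-monoˡ-≤ 1 (ℕ.≰⇒> n₀≰d) , dim)) , x∈C
      where
      n₀≰d : ¬ (n₀ ℕ.≤ d)
      n₀≰d n₀≤d = let z , z∈C , z∉B = full-cell-meets-complement L transversal C∈ dim n₀≤d
        in z∉B (proj₂ (bent≐zeros L) (i , f≈0 z∈C))

    -- A cell containing a point off the arrangement is a neighbourhood of it and so has dimension
    -- at least `n₀`.
    skeleton⊆bent : .{{_ : NonZero n₀}} (L : HiddenLayers {n₀} a) → domain (skeleton (n₀ ∸ 1) (layerComplex L)) ⊆ layersBent L
    skeleton⊆bent L (C , (_ , inj₁ (C⊆∅ , _)) , x∈C) = ⊥-elim (C⊆∅ x∈C)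
    skeleton⊆bent {n₀} L {x} (C , (C∈ , inj₂ (d , d≤ , dim)) , x∈C) with em {P = x ∈ layersBent L}
    ... | yes p  = p
    ... | no x∉B = ⊥-elim (ℕ.<⇒≱ (ℕ.≤-<-trans d≤ (pred< n₀)) (full⇒≤dimension {S = C} dim (cell-off-full L C∈ x∈C x∉B)))
      where
      -- Subtraction is truncated, so strictness rests on `n` being positive.
      pred< : ∀ n → .{{NonZero n}} → n ∸ 1 ℕ.< n
      pred< (suc n) = ℕ.≤-refl

    closure⇒cell : (L : HiddenLayers {n₀} a) {C K : Subset n₀} → ConnectedComponent (∁ (layersBent L)) K → C ≐ closure K →
                   CellOf L C × HasDimension C n₀
    closure⇒cell L {C} {K} comp@((x , x∈K) , K⊆∁B , _) C≐ =
      C∈ , full⇒dimension {S = C} (cell-off-full L C∈ (proj₂ C≐weak (weak-self L x)) (K⊆∁B x∈K))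
      where
      C≐weak : C ≐ WeakRegion L x
      C≐weak = ≐-trans C≐ (LayerRegions.Components.component-closure L (star L) comp x∈K)
      C∈ : CellOf L C
      C∈ = layerComplex-resp L (≐-sym C≐weak) (weakRegion-cell L x (K⊆∁B x∈K))

    -- The point of `C` off the arrangement determines the activation region: `C` is its weak
    -- region, which is the closure of its strict one.
    cell⇒closure : .{{_ : NonZero n₀}} (L : HiddenLayers {n₀} a) → TransversalLayers L → {C : Subset n₀} →
                   CellOf L C → HasDimension C n₀ → ∃[ K ] (ConnectedComponent (∁ (layersBent L)) K × C ≐ closure K)
    cell⇒closure L transversal {C} C∈ dim
      with full-cell-meets-complement L transversal C∈ dim ℕ.≤-refl
    ... | x , x∈C , x∉B = Region L x , LayerRegions.Components.region-component L (star L) x∉B ,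
          ≐-trans (cell-off L C∈ x∈C x∉B) (≐-sym (LayerRegions.Components.closure-region L (star L) x∉B))

theorem2 : (∀ {ℓ} → ExcludedMiddle ℓ) →
    (R : RealNumbers) → let open ReLUNetworks R in
    {n₀ : ℕ} .{{_ : NonZero n₀}} (a : Architecture n₀) (F : Network a) →
    Transversal F →
    (bentArrangement F ≐ domain (skeleton (n₀ ∸ 1) (canonicalComplex F))) ×
    (∀ C → (∃[ K ] (ActivationRegion F K × C ≐ closure K)) ⇔
           (C ∈ canonicalComplex F × HasDimension C n₀))
theorem2 em R a (ReLUNetworks.network L _) transversal =
  (bent⊆skeleton L transversal , skeleton⊆bent L) ,
  λ C → mk⇔ (λ { (K , component , C≐) → closure⇒cell L component C≐ })
            (λ { (C∈ , dim) → cell⇒closure L transversal C∈ dim })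
  where open Transversality em R
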